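{- Let $M=(E,\mathcal{I})$ be a matroid with $\operatorname{rank}(M)\ge 2$. For any $e\in E$, the basis generating polynomial $f_M$ satisfies $\mathrm{HRR}_1$ on $\operatorname{relint}(H_e)$ if and only if $e$ is not a coloop of $M$. Here $H_e=\{x\in\mathbb{R}_{\ge0}^E: x_e=0\}$, so that $\operatorname{relint}(H_e)=\{x\in\mathbb{R}^E: x_e=0,\ x_i>0\text{ for all }i\ne e\}$.
   Context: Let $M$ be a matroid of rank $d$ on the finite set $E$ with basis set $\mathcal{B}$. Its basis generating polynomial is $f_M=\sum_{B\in\mathcal{B}}\prod_{e\in B}x_e\in\mathbb{R}[x_e:e\in E]$. A coloop is an element contained in every basis. Let $S=\mathbb{R}[\partial_e: e\in E]$ act on $\mathbb{R}[x_e:e\in E]$ with $\partial_e=\partial/\partial x_e$, let $\operatorname{Ann}(f_M)=\{\xi\in S:\xi(f_M)=0\}$, and let $A(M)=S/\operatorname{Ann}(f_M)=\bigoplus_{i=0}^d A^i(M)$, graded by degree of differential forms. The isomorphism $\deg:A^d(M)\to\mathbb{R}$ is $\xi\mapsto\xi(f_M)$. For $l\in A^1(M)$ and an integer $0\le k\le d/2$: the Hodge–Riemann form is $Q_l^k(\xi_1,\xi_2)=(-1)^k\deg(\xi_1\xi_2 l^{d-2k})$ on $A^k(M)$, and the primitive subspace is $P_l^k=\{\xi\in A^k(M): l^{d-2k+1}\xi=0\}$. $A(M)$ (equivalently $f_M$) satisfies $\mathrm{HRR}_k$ with respect to $l$ if $Q_l^k$ is positive definite on $P_l^k$. For $a\in\mathbb{R}^E$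 put $l_a=\sum_{e\in E}a_e\partial_e$; "$f_M$ satisfies $\mathrm{HRR}_1$ on a set $\Omega\subseteq\mathbb{R}^E$" means that $\mathrm{HRR}_1$ holds with respect to $l_a$ for every $a\in\Omega$. -}

module Defs where

open import Algebra.Bundles using (CommutativeRing)
import Algebra.Properties.Semiring.Exp as Exp
import Algebra.Properties.Semiring.Mult as Mult
open import Data.Bool.Base using (if_then_else_)
open import Data.Fin.Base using (Fin)
open import Data.Fin.Subset using (Subset; inside; outside; _∈_; _∉_; _⊆_; _⊂_; _∪_; ⁅_⁆; ⊥; ∣_∣)
open import Data.Fin.Subset.Properties using (anySubset?; _⊂?_)
open import Data.List.Base using (List; []; _∷_; [_]; _++_; map; concatMap; cartesianProductWith; filter; foldr; allFin)
open import Data.List.Extrema.Nat using (max)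
open import Data.Nat.Base as ℕ using (ℕ; zero; suc; pred; _∸_)
import Data.Nat.Properties as ℕₚ
open import Data.Nat.GeneralisedArithmetic using (fold)
open import Data.Product.Base using (_×_; _,_; ∃)
open import Data.Vec.Base as Vec using (Vec; lookup; replicate; updateAt; zipWith)
open import Data.Vec.Functional using (Vector)
open import Data.Vec.Properties using (≡-dec)
open import Level using (Level; _⊔_; 0ℓ) renaming (suc to lsuc)
open import Relation.Binary.Core using (Rel)
import Relation.Binary.Construct.StrictToNonStrict as StrictToNonStrict
open import Relation.Binary.Definitions using (DecidableEquality)
open import Relation.Binary.PropositionalEquality.Core using (_≡_; _≢_)
open import Relation.Binary.Structures using (IsStrictTotalOrder)
open import Relation.Nullary using (¬_; does)
open import Relation.Nullary.Decidable using (_×-dec_; ¬?)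
open import Relation.Unary using (Pred; Decidable)

-- The real numbers, axiomatised as a Dedekind-complete ordered field (unique up
-- to isomorphism).  The order is classical: `isStrictTotalOrder` includes
-- trichotomy.

record CompleteOrderedField c ℓ : Set (lsuc (c ⊔ ℓ)) where
  infix 4 _<_
  field
    commutativeRing : CommutativeRing c ℓ

  open CommutativeRing commutativeRing public

  field
    _<_                : Rel Carrier ℓ
    isStrictTotalOrder : IsStrictTotalOrder _≈_ _<_
    0≉1                : ¬ 0# ≈ 1#
    inverse            : ∀ x → ¬ x ≈ 0# → ∃ λ y → x * y ≈ 1#
    +-monoˡ-<          : ∀ z {x y} → x < y → x + z < y + z
    *-pos              : ∀ {x y} → 0# < x → 0# < y → 0# < x * y

  open StrictToNonStrict _≈_ _<_ public using (_≤_)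

  UpperBound : Pred Carrier (c ⊔ ℓ) → Pred Carrier (c ⊔ ℓ)
  UpperBound P b = ∀ x → P x → x ≤ b

  field
    supremum : ∀ (P : Pred Carrier (c ⊔ ℓ)) → ∃ P → ∃ (UpperBound P) →
               ∃ λ s → UpperBound P s × (∀ b → UpperBound P b → s ≤ b)

record Matroid (n : ℕ) : Set₁ where
  field
    Indep        : Pred (Subset n) 0ℓ
    Indep?       : Decidable Indep
    empty        : Indep ⊥
    hereditary   : ∀ {I J} → I ⊆ J → Indep J → Indep I
    augmentation : ∀ {I J} → Indep I → Indep J → ∣ I ∣ ℕ.< ∣ J ∣ →
                   ∃ λ x → x ∈ J × x ∉ I × Indep (I ∪ ⁅ x ⁆)

subsets : ∀ n → List (Subset n)
subsets zero    = [ Vec.[] ]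
subsets (suc n) = map (inside Vec.∷_) (subsets n) ++ map (outside Vec.∷_) (subsets n)

module _ {n : ℕ} (M : Matroid n) where
  open Matroid M

  Basis : Pred (Subset n) 0ℓ
  Basis B = Indep B × ¬ ∃ λ J → Indep J × B ⊂ J

  Basis? : Decidable Basis
  Basis? B = Indep? B ×-dec ¬? (anySubset? (λ J → Indep? J ×-dec B ⊂? J))

  rank : ℕ
  rank = max 0 (map ∣_∣ (filter Indep? (subsets n)))

  Coloop : Pred (Fin n) 0ℓ
  Coloop e = ∀ B → Basis B → e ∈ B

Exponent : ℕ → Set
Exponent n = Vec ℕ n

_≟ᴱ_ : ∀ {n} → DecidableEquality (Exponent n)
_≟ᴱ_ = ≡-dec ℕₚ._≟_

indicator : ∀ {n} → Subset n → Exponent n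
indicator = Vec.map (λ b → if b then 1 else 0)

module Polynomials {c ℓ} (ℝ : CompleteOrderedField c ℓ) (n : ℕ) where
  open CompleteOrderedField ℝ
  open Mult semiring using () renaming (_×_ to _·_)

  -- A polynomial is a formal sum of terms (coefficient , exponent), in which an
  -- exponent may be repeated and coefficients may vanish; hence equality `_≈ₚ_`
  -- compares coefficients.

  Poly : Set c
  Poly = List (Carrier × Exponent n)

  coeff : Poly → Exponent n → Carrier
  coeff p α = foldr (λ (a , β) s → if does (β ≟ᴱ α) then a + s else s) 0# p

  infix 4 _≈ₚ_
  _≈ₚ_ : Rel Poly ℓ
  p ≈ₚ q = ∀ α → coeff p α ≈ coeff q α

  0ₚ 1ₚ : Poly
  0ₚ = []
  1ₚ = [ 1# , replicate n 0 ]

  infixl 6 _+ₚ_ _-ₚ_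
  infixl 7 _*ₚ_
  infixr 8 _∙ₚ_ _^ₚ_

  _+ₚ_ : Poly → Poly → Poly
  _+ₚ_ = _++_

  _∙ₚ_ : Carrier → Poly → Poly
  a ∙ₚ p = map (λ (b , β) → a * b , β) p

  _-ₚ_ : Poly → Poly → Poly
  p -ₚ q = p +ₚ (- 1#) ∙ₚ q

  _*ₚ_ : Poly → Poly → Poly
  _*ₚ_ = cartesianProductWith (λ (a , α) (b , β) → a * b , zipWith ℕ._+_ α β)

  _^ₚ_ : Poly → ℕ → Poly
  p ^ₚ m = fold 1ₚ (p *ₚ_) m

  Homogeneous : ℕ → Pred Poly ℓ
  Homogeneous k p = ∀ α → ¬ coeff p α ≈ 0# → Vec.sum α ≡ k

  -- If the exponent of x_e is 0 the coefficient becomes 0 · a = 0#, so the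
  -- truncation in `pred` is harmless.

  ∂ : Fin n → Poly → Poly
  ∂ e = map (λ (a , α) → lookup α e · a , updateAt α e pred)

  ∂^ : Exponent n → Poly → Poly
  ∂^ β p = foldr (λ e q → fold q (∂ e) (lookup β e)) p (allFin n)

  -- `Poly` also represents S = ℝ[∂_e], the exponent β standing for ∂^β;
  -- `ξ • p` is the action of the differential operator ξ.

  infixr 7 _•_
  _•_ : Poly → Poly → Poly
  ξ • p = concatMap (λ (a , β) → a ∙ₚ ∂^ β p) ξ

  linear : Vector Carrier n → Poly
  linear a = map (λ e → a e , indicator ⁅ e ⁆) (allFin n)

-- The graded algebra A = S / Ann(f) of a form f of degree d.  Elements of A are
-- represented by elements of S, compared by `_≈ᴬ_`; elements of A^k are
-- represented by homogeneous elements of S of degree k.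

module GradedAlgebra {c ℓ} (ℝ : CompleteOrderedField c ℓ) (n : ℕ)
                     (f : Polynomials.Poly ℝ n) (d : ℕ) where
  open CompleteOrderedField ℝ
  open Exp semiring using (_^_)
  open Polynomials ℝ n

  Ann : Pred Poly ℓ
  Ann ξ = ξ • f ≈ₚ 0ₚ

  infix 4 _≈ᴬ_
  _≈ᴬ_ : Rel Poly ℓ
  ξ ≈ᴬ η = Ann (ξ -ₚ η)

  -- For ξ of degree d the polynomial ξ • f is constant; deg ξ is its value.

  deg : Poly → Carrier
  deg ξ = coeff (ξ • f) (replicate n 0)

  -- The exponents d ∸ 2k below are meaningful for 2k ≤ d only.

  Q : ℕ → Poly → Poly → Poly → Carrier
  Q k l ξ₁ ξ₂ = (- 1#) ^ k * deg (ξ₁ *ₚ ξ₂ *ₚ l ^ₚ (d ∸ 2 ℕ.* k))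

  Primitive : ℕ → Poly → Pred Poly ℓ
  Primitive k l ξ = Homogeneous k ξ × l ^ₚ suc (d ∸ 2 ℕ.* k) *ₚ ξ ≈ᴬ 0ₚ

  HRR : ℕ → Poly → Set (c ⊔ ℓ)
  HRR k l = ∀ ξ → Primitive k l ξ → ¬ ξ ≈ᴬ 0ₚ → 0# < Q k l ξ ξ

  HRR-on : ∀ {p} → ℕ → Pred (Vector Carrier n) p → Set (c ⊔ ℓ ⊔ p)
  HRR-on k Ω = ∀ a → Ω a → HRR k (linear a)

module _ {c ℓ} (ℝ : CompleteOrderedField c ℓ) {n : ℕ} where
  open CompleteOrderedField ℝ
  open Polynomials ℝ n

  basisPolynomial : Matroid n → Poly
  basisPolynomial M = map (λ B → 1# , indicator B) (filter (Basis? M) (subsets n))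

  MatroidHRR-on : ∀ {p} → Matroid n → ℕ → Pred (Vector Carrier n) p → Set (c ⊔ ℓ ⊔ p)
  MatroidHRR-on M = GradedAlgebra.HRR-on ℝ n (basisPolynomial M) (rank M)

  -- The relative interior of the facet {x ≥ 0 : x_e = 0} of the orthant.

  relintH : Fin n → Pred (Vector Carrier n) ℓ
  relintH e x = x e ≈ 0# × (∀ i → i ≢ e → 0# < x i)

{-# OPTIONS --safe #-}
module Submission where

-- Contracting l_a^{d-2} with f_M gives a symmetric form H on linear forms, and HRR₁ says
-- that H is negative semidefinite on the complement of a, its isotropic vectors there
-- being the v with l_v f_M = 0. The form of f_M is Σ a_i times the forms of the
-- contractions ∂_i f_M, so by induction on the degree the reverse Cauchy–Schwarz
-- inequality for these yields H ≤ H D H with D = diag(a_i / (H a)_i), with 0 where (H a)_i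
-- = 0. Every v in the complement of a has the form (1 - D H) w, because the kernel of the
-- transpose is spanned by H a: a weighted Laplacian whose connectedness is the exchange
-- axiom. Then, with u = D H w, H(v, v) = (H(w, w) - H D H(w, w)) + (H(u, u) - H D H(w, w))
-- is a sum of two nonpositive terms, the second by positivity of the Laplacian; no
-- spectral theorem is needed. An element e that is not a coloop enters through a basis
-- avoiding e, which makes H(a, a) positive although a_e = 0. If e is a coloop then l_a^d
-- f_M = 0, so ξ = l_a is primitive with Q(ξ, ξ) = 0.

open import Algebra.Bundles using (CommutativeRing)
import Algebra.Properties.AbelianGroup as AbelianGroupProperties
import Algebra.Properties.CommutativeMonoid.Mult as CommutativeMonoidMult
import Algebra.Properties.Ring as RingProperties
import Algebra.Properties.Semiring.Mult as Mult
import Algebra.Properties.Semiring.Mult.TCOptimised as Multiples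
import Algebra.Properties.Semiring.Sum as Sums
import Algebra.Solver.Ring as RingSolver
import Algebra.Solver.Ring.AlmostCommutativeRing as ACR
open import Data.Bool.Base using (true; false; if_then_else_)
open import Data.Fin.Base using (Fin; zero; suc)
import Data.Fin.Properties as Finₚ
open import Data.Fin.Subset as Subset using (Subset; inside; outside; _∈_; _∉_; _∪_; ⁅_⁆; ∣_∣)
import Data.Fin.Subset.Properties as Subsetₚ
open import Data.Integer.Base as ℤ using (ℤ; +_; -[1+_])
import Data.Integer.Properties as ℤₚ
open import Data.List.Base using (List; []; _∷_; _++_; map; filter; foldr; allFin; tabulate)
import Data.List.Extrema as Extrema
open import Data.List.Extrema.Nat using (xs≤max)
open import Data.List.Membership.Propositional using () renaming (_∈_ to _∈ˡ_)
open import Data.List.Membership.Propositional.Properties using (∈-map⁺; ∈-map⁻; ∈-filter⁺; ∈-filter⁻; ∈-++⁺ˡ; ∈-++⁺ʳ)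
import Data.List.Properties as Listₚ
open import Data.List.Relation.Unary.All as All using (All; []; _∷_)
open import Data.List.Relation.Unary.AllPairs using ([]; _∷_)
open import Data.List.Relation.Unary.Any using (here; there)
open import Data.List.Relation.Unary.Unique.Propositional using (Unique)
import Data.List.Relation.Unary.Unique.Propositional.Properties as Uniqueₚ
open import Data.Maybe.Base as Maybe using (Maybe)
open import Data.Nat.Base as ℕ using (ℕ; zero; suc; pred; s≤s; z≤n)
open import Data.Nat.GeneralisedArithmetic using (fold)
import Data.Nat.Properties as ℕₚ
open import Data.Product.Base using (_×_; _,_; ∃; proj₁; proj₂)
open import Data.Sum.Base using (_⊎_; inj₁; inj₂)
open import Data.Vec.Base as Vec using ([]; _∷_; lookup; replicate; updateAt; zipWith)
open import Data.Vec.Functional using (Vector)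
import Data.Vec.Properties as Vecₚ
open import Defs
open import Function.Base using (case_of_)
open import Function.Bundles using (_⇔_; mk⇔)
open import Level using (Level)
open import Relation.Binary.Definitions using (tri<; tri≈; tri>)
import Relation.Binary.Construct.StrictToNonStrict as StrictToNonStrict
open import Relation.Binary.PropositionalEquality as ≡ using (_≡_; _≢_; cong; cong₂)
import Relation.Binary.Reasoning.Setoid as SetoidReasoning
open import Relation.Binary.Structures using (IsStrictTotalOrder)
open import Relation.Nullary using (¬_; Dec; yes; no; does)
open import Relation.Nullary.Decidable using (¬?; _×-dec_; dec⇒maybe; decidable-stable)
open import Relation.Nullary.Negation using (contradiction)
open import Relation.Unary using (Pred; Decidable)

-- In spectral terms, when D is invertible, D H is self-adjoint for the inner product given by the
-- inverse of D, and conjugating it by diag(a) gives the transition matrix of a random walk. H ≤ H D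
-- H says that its eigenvalues satisfy λ ≤ λ², positivity of the weights gives λ ≤ 1, and
-- connectedness makes 1 a simple eigenvalue, with eigenvector a; all others are therefore ≤ 0. This
-- is the trickle-down argument for random walks on simplicial complexes. Solving v = (1 - D H) w
-- extracts the conclusion without eigenvectors and keeps its sense when D is singular, which must
-- be allowed: a_e = 0, and a loop i of a contraction has (H a)_i = 0. The zero weight also hides
-- ∂_e in l_a, so isotropy passes directly only to the contractions by i ≠ e. Contractions are
-- represented by exponents α, through the values at 0 of ∂^α l_a^k f_M, so that one matroid and one
-- basis avoiding e serve the whole induction.

private variable
  n : ℕ

-- A ring solver with integer coefficients.

module IntegerCoefficients {c ℓ} (R : CommutativeRing c ℓ) where
  open CommutativeRing R
  open Multiples semiring using (1+×; ×-homo-+; ×1-homo-*) renaming (_×_ to _·_)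
  open RingProperties ring
  open AbelianGroupProperties +-abelianGroup using (ε⁻¹≈ε; ⁻¹-∙-comm; ⁻¹-involutive)
  open SetoidReasoning setoid

  -- With the optimised multiples `1 · 1#` is `1#` by definition, so `:0` and `:1` stand for `0#`
  -- and `1#` themselves in solver equations.
  fromℤ : ℤ → Carrier
  fromℤ (+ n)    = n · 1#
  fromℤ -[1+ n ] = - (suc n · 1#)

  private
    cancel-suc : ∀ x y → x - y ≈ (1# + x) - (1# + y)
    cancel-suc x y = sym (begin
      (1# + x) + - (1# + y)      ≈⟨ +-cong (+-comm x 1#) (⁻¹-∙-comm 1# y) ⟨
      (x + 1#) + (- 1# + - y)    ≈⟨ +-assoc x 1# _ ⟩
      x + (1# + (- 1# + - y))    ≈⟨ +-congˡ (+-assoc 1# (- 1#) (- y)) ⟨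
      x + ((1# + - 1#) + - y)    ≈⟨ +-congˡ (+-congʳ (-‿inverseʳ 1#)) ⟩
      x + (0# + - y)             ≈⟨ +-congˡ (+-identityˡ (- y)) ⟩
      x - y                      ∎)

  fromℤ-⊖ : ∀ m n → fromℤ (m ℤ.⊖ n) ≈ m · 1# - n · 1#
  fromℤ-⊖ zero    zero    = sym (-‿inverseʳ 0#)
  fromℤ-⊖ zero    (suc n) = sym (+-identityˡ _)
  fromℤ-⊖ (suc m) zero    = sym (trans (+-congˡ ε⁻¹≈ε) (+-identityʳ _))
  fromℤ-⊖ (suc m) (suc n) rewrite ℤₚ.[1+m]⊖[1+n]≡m⊖n m n =
    trans (fromℤ-⊖ m n) (trans (cancel-suc _ _)
      (sym (+-cong (1+× m 1#) (-‿cong (1+× n 1#)))))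

  fromℤ-+ : ∀ i j → fromℤ (i ℤ.+ j) ≈ fromℤ i + fromℤ j
  fromℤ-+ (+ m)    (+ n)    = ×-homo-+ 1# m n
  fromℤ-+ (+ m)    -[1+ n ] = fromℤ-⊖ m (suc n)
  fromℤ-+ -[1+ m ] (+ n)    = trans (fromℤ-⊖ n (suc m)) (+-comm _ _)
  fromℤ-+ -[1+ m ] -[1+ n ] = begin
    - (suc (suc (m ℕ.+ n)) · 1#)         ≡⟨ ≡.cong (λ k → - (k · 1#)) (≡.cong suc (≡.sym (ℕₚ.+-suc m n))) ⟩
    - ((suc m ℕ.+ suc n) · 1#)           ≈⟨ -‿cong (×-homo-+ 1# (suc m) (suc n)) ⟩
    - (suc m · 1# + suc n · 1#)          ≈⟨ ⁻¹-∙-comm _ _ ⟨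
    - (suc m · 1#) + - (suc n · 1#)      ∎

  fromℤ-neg : ∀ i → fromℤ (ℤ.- i) ≈ - fromℤ i
  fromℤ-neg (+ zero)  = sym ε⁻¹≈ε
  fromℤ-neg (+ suc n) = refl
  fromℤ-neg -[1+ n ]  = sym (⁻¹-involutive _)

  fromℤ-pos-* : ∀ m j → fromℤ (+ m ℤ.* j) ≈ m · 1# * fromℤ j
  fromℤ-pos-* m (+ n) rewrite ≡.sym (ℤₚ.pos-* m n) = ×1-homo-* m n
  fromℤ-pos-* m -[1+ n ] rewrite ≡.sym (ℤₚ.neg-distribʳ-* (+ m) (+ suc n)) = begin
    fromℤ (ℤ.- (+ m ℤ.* + suc n))    ≈⟨ fromℤ-neg (+ m ℤ.* + suc n) ⟩
    - fromℤ (+ m ℤ.* + suc n)        ≈⟨ -‿cong (fromℤ-pos-* m (+ suc n)) ⟩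
    - (m · 1# * suc n · 1#)          ≈⟨ -‿distribʳ-* _ _ ⟩
    m · 1# * - (suc n · 1#)          ∎

  fromℤ-* : ∀ i j → fromℤ (i ℤ.* j) ≈ fromℤ i * fromℤ j
  fromℤ-* (+ m) j = fromℤ-pos-* m j
  fromℤ-* -[1+ m ] j rewrite ≡.sym (ℤₚ.neg-distribˡ-* (+ suc m) j) = begin
    fromℤ (ℤ.- (+ suc m ℤ.* j))      ≈⟨ fromℤ-neg (+ suc m ℤ.* j) ⟩
    - fromℤ (+ suc m ℤ.* j)          ≈⟨ -‿cong (fromℤ-pos-* (suc m) j) ⟩
    - (suc m · 1# * fromℤ j)         ≈⟨ -‿distribˡ-* _ _ ⟩
    - (suc m · 1#) * fromℤ j         ∎

  almostCommutativeRing : ACR.AlmostCommutativeRing c ℓ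
  almostCommutativeRing = record
    { isAlmostCommutativeRing = record
      { isCommutativeSemiring = isCommutativeSemiring
      ; -‿cong                = -‿cong
      ; -‿*-distribˡ          = λ x y → sym (-‿distribˡ-* x y)
      ; -‿+-comm              = ⁻¹-∙-comm
      }
    }

  fromℤ-morphism : ℤ.+-*-rawRing ACR.-Raw-AlmostCommutative⟶ almostCommutativeRing
  fromℤ-morphism = record
    { ⟦_⟧    = fromℤ
    ; +-homo = fromℤ-+
    ; *-homo = fromℤ-*
    ; -‿homo = fromℤ-neg
    ; 0-homo = refl
    ; 1-homo = refl
    }

  -- Equality of integers computes, unlike the trichotomy of an abstract field, so the solver can
  -- see coefficients cancel.
  fromℤ-≟ : ∀ i j → Maybe (fromℤ i ≈ fromℤ j)
  fromℤ-≟ i j = Maybe.map (λ { ≡.refl → refl }) (dec⇒maybe (i ℤₚ.≟ j))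

  open RingSolver ℤ.+-*-rawRing almostCommutativeRing fromℤ-morphism fromℤ-≟
    public using (Polynomial; solve; _:=_; _:+_; _:*_; _:-_; :-_; con)

  :0 :1 : ∀ {n} → Polynomial n
  :0 = con (+ 0)
  :1 = con (+ 1)

-- Ordered fields and finite sums.

module OrderedField {c ℓ} (ℝ : CompleteOrderedField c ℓ) where
  open CompleteOrderedField ℝ public hiding (zero)
  open IsStrictTotalOrder isStrictTotalOrder public
    using (compare; _≟_; irrefl; <-respʳ-≈; <-respˡ-≈) renaming (trans to <-trans)
  open Sums semiring public
    using (sum; sum-cong-≋; ∑-distrib-+; ∑-comm; *-distribˡ-sum; *-distribʳ-sum; sum-replicate-zero)
  open IntegerCoefficients commutativeRing public hiding (almostCommutativeRing)
  open SetoidReasoning setoid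

  private variable
    x y z : Carrier

  <-≤-trans : x < y → y ≤ z → x < z
  <-≤-trans = StrictToNonStrict.<-≤-trans _≈_ _<_ <-trans <-respʳ-≈

  ≤-respʳ-≈ : y ≈ z → x ≤ y → x ≤ z
  ≤-respʳ-≈ = StrictToNonStrict.≤-respʳ-≈ _≈_ _<_ trans <-respʳ-≈

  ≤-respˡ-≈ : y ≈ z → y ≤ x → z ≤ x
  ≤-respˡ-≈ = StrictToNonStrict.≤-respˡ-≈ _≈_ _<_ sym trans <-respˡ-≈

  ≤-antisym : x ≤ y → y ≤ x → x ≈ y
  ≤-antisym = StrictToNonStrict.antisym _≈_ _<_ isEquivalence <-trans irrefl

  ≤-refl : x ≤ x
  ≤-refl = inj₂ refl

  ≮⇒≥ : ¬ x < y → y ≤ x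
  ≮⇒≥ {x} {y} x≮y with compare x y
  ... | tri< x<y _ _ = contradiction x<y x≮y
  ... | tri≈ _ x≈y _ = inj₂ (sym x≈y)
  ... | tri> _ _ y<x = inj₁ y<x

  <0⇒0<- : x < 0# → 0# < - x
  <0⇒0<- {x} x<0 = <-respʳ-≈ (+-identityˡ _) (<-respˡ-≈ (-‿inverseʳ x) (+-monoˡ-< (- x) x<0))

  ≤⇒0≤- : x ≤ y → 0# ≤ y - x
  ≤⇒0≤- {x} (inj₁ x<y) = inj₁ (<-respˡ-≈ (-‿inverseʳ x) (+-monoˡ-< (- x) x<y))
  ≤⇒0≤- {x} (inj₂ x≈y) = inj₂ (sym (trans (+-congʳ (sym x≈y)) (-‿inverseʳ x)))

  0≤-⇒≤ : 0# ≤ y - x → x ≤ y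
  0≤-⇒≤ {y} {x} (inj₁ 0<y-x) = inj₁ (<-respˡ-≈ (+-identityˡ x)
    (<-respʳ-≈ (solve 2 (λ x y → (y :- x) :+ x := y) refl x y) (+-monoˡ-< x 0<y-x)))
  0≤-⇒≤ {y} {x} (inj₂ 0≈y-x) = inj₂ (sym (begin
    y              ≈⟨ solve 2 (λ x y → y := (y :- x) :+ x) refl x y ⟩
    (y - x) + x    ≈⟨ +-congʳ 0≈y-x ⟨
    0# + x         ≈⟨ +-identityˡ x ⟩
    x              ∎))

  +-pos-nonneg : 0# < x → 0# ≤ y → 0# < x + y
  +-pos-nonneg {x} {y} 0<x (inj₁ 0<y) = <-trans 0<y (<-respˡ-≈ (+-identityˡ y) (+-monoˡ-< y 0<x))
  +-pos-nonneg {x} {y} 0<x (inj₂ 0≈y) = <-respʳ-≈ (trans (sym (+-identityʳ x)) (+-congˡ 0≈y)) 0<x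

  +-nonneg : 0# ≤ x → 0# ≤ y → 0# ≤ x + y
  +-nonneg (inj₁ 0<x) 0≤y = inj₁ (+-pos-nonneg 0<x 0≤y)
  +-nonneg (inj₂ 0≈x) 0≤y = ≤-respʳ-≈ (trans (sym (+-identityˡ _)) (+-congʳ 0≈x)) 0≤y

  *-nonneg : 0# ≤ x → 0# ≤ y → 0# ≤ x * y
  *-nonneg (inj₁ 0<x) (inj₁ 0<y) = inj₁ (*-pos 0<x 0<y)
  *-nonneg (inj₁ 0<x) (inj₂ 0≈y) = inj₂ (sym (trans (*-congˡ (sym 0≈y)) (zeroʳ _)))
  *-nonneg (inj₂ 0≈x) _          = inj₂ (sym (trans (*-congʳ (sym 0≈x)) (zeroˡ _)))

  +-mono-≤ : ∀ {w} → w ≤ x → y ≤ z → w + y ≤ x + z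
  +-mono-≤ {x} {y} {z} {w} w≤x y≤z = 0≤-⇒≤ (≤-respʳ-≈
    (solve 4 (λ w x y z → (x :- w) :+ (z :- y) := (x :+ z) :- (w :+ y)) refl w x y z)
    (+-nonneg (≤⇒0≤- w≤x) (≤⇒0≤- y≤z)))

  *-monoˡ-≤ : 0# ≤ z → x ≤ y → z * x ≤ z * y
  *-monoˡ-≤ {z} {x} {y} 0≤z x≤y = 0≤-⇒≤ (≤-respʳ-≈
    (solve 3 (λ x y z → z :* (y :- x) := z :* y :- z :* x) refl x y z)
    (*-nonneg 0≤z (≤⇒0≤- x≤y)))

  ≉0⇒0<² : ¬ x ≈ 0# → 0# < x * x
  ≉0⇒0<² {x} x≉0 with compare x 0#
  ... | tri< x<0 _ _ = <-respʳ-≈ (solve 1 (λ x → (:- x) :* (:- x) := x :* x) refl x)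
                                 (*-pos (<0⇒0<- x<0) (<0⇒0<- x<0))
  ... | tri≈ _ x≈0 _ = contradiction x≈0 x≉0
  ... | tri> _ _ 0<x = *-pos 0<x 0<x

  0≤² : ∀ x → 0# ≤ x * x
  0≤² x with compare x 0#
  ... | tri≈ _ x≈0 _ = inj₂ (sym (trans (*-congʳ x≈0) (zeroˡ x)))
  ... | tri< _ x≉0 _ = inj₁ (≉0⇒0<² x≉0)
  ... | tri> _ x≉0 _ = inj₁ (≉0⇒0<² x≉0)

  0<1 : 0# < 1#
  0<1 = <-respʳ-≈ (*-identityʳ 1#) (≉0⇒0<² (λ 1≈0 → 0≉1 (sym 1≈0)))

  ²≈0⇒≈0 : x * x ≈ 0# → x ≈ 0#
  ²≈0⇒≈0 {x} x²≈0 with compare x 0#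
  ... | tri≈ _ x≈0 _ = x≈0
  ... | tri< _ x≉0 _ = contradiction (≉0⇒0<² x≉0) (irrefl (sym x²≈0))
  ... | tri> _ x≉0 _ = contradiction (≉0⇒0<² x≉0) (irrefl (sym x²≈0))

  *-cancel-≈0 : 0# < x → x * y ≈ 0# → y ≈ 0#
  *-cancel-≈0 {x} {y} 0<x xy≈0 with compare y 0#
  ... | tri≈ _ y≈0 _ = y≈0
  ... | tri> _ _ 0<y = contradiction (*-pos 0<x 0<y) (irrefl (sym xy≈0))
  ... | tri< y<0 _ _ = contradiction (*-pos 0<x (<0⇒0<- y<0)) (irrefl (begin
    0#         ≈⟨ solve 0 (:0 := :- :0) refl ⟩
    - 0#       ≈⟨ -‿cong xy≈0 ⟨
    - (x * y)  ≈⟨ solve 2 (λ x y → :- (x :* y) := x :* (:- y)) refl x y ⟩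
    x * - y    ∎))

  *-cancel-0≤ : 0# < x → 0# ≤ x * y → 0# ≤ y
  *-cancel-0≤ {x} {y} 0<x 0≤xy = ≮⇒≥ λ y<0 →
    irrefl refl (<-≤-trans (<-respʳ-≈ (solve 2 (λ x y → x :* (:- y) :+ x :* y := :0) refl x y)
      (+-pos-nonneg (*-pos 0<x (<0⇒0<- y<0)) 0≤xy)) ≤-refl)

  -‿nonpos : ∀ {x} → x ≤ 0# → 0# ≤ - x
  -‿nonpos (inj₁ x<0) = inj₁ (<0⇒0<- x<0)
  -‿nonpos {x} (inj₂ x≈0) = inj₂ (trans (solve 0 (:0 := :- :0) refl) (-‿cong (sym x≈0)))

  -- The inverse of a positive number, and the junk value 0 elsewhere.
  infix 8 _⁺⁻¹
  _⁺⁻¹ : Carrier → Carrier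
  x ⁺⁻¹ with compare x 0#
  ... | tri< _ _ _   = 0#
  ... | tri≈ _ _ _   = 0#
  ... | tri> _ x≉0 _ = proj₁ (inverse x x≉0)

  *-⁺⁻¹ : 0# < x → x * x ⁺⁻¹ ≈ 1#
  *-⁺⁻¹ {x} 0<x with compare x 0#
  ... | tri< _ _ 0≮x = contradiction 0<x 0≮x
  ... | tri≈ _ _ 0≮x = contradiction 0<x 0≮x
  ... | tri> _ x≉0 _ = proj₂ (inverse x x≉0)

  ⁺⁻¹-nonneg : ∀ x → 0# ≤ x ⁺⁻¹
  ⁺⁻¹-nonneg x with compare x 0#
  ... | tri< _ _ _ = ≤-refl
  ... | tri≈ _ _ _ = ≤-refl
  ... | tri> _ x≉0 0<x = *-cancel-0≤ 0<x (inj₁ (<-respʳ-≈ (sym (proj₂ (inverse x x≉0))) 0<1))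

  -- Valid at the junk value too, so the weights `a i * row a i ⁺⁻¹` can be handled without asking
  -- whether `row a i` vanishes.
  ⁺⁻¹-idem : ∀ x → x * (x ⁺⁻¹ * x ⁺⁻¹) ≈ x ⁺⁻¹
  ⁺⁻¹-idem x with compare x 0#
  ... | tri< _ _ _   = solve 1 (λ x → x :* (:0 :* :0) := :0) refl x
  ... | tri≈ _ _ _   = solve 1 (λ x → x :* (:0 :* :0) := :0) refl x
  ... | tri> _ x≉0 _ = let (y , xy≈1) = inverse x x≉0 in begin
    x * (y * y)    ≈⟨ *-assoc x y y ⟨
    (x * y) * y    ≈⟨ *-congʳ xy≈1 ⟩
    1# * y         ≈⟨ *-identityˡ y ⟩
    y              ∎

  sum-cong : {f g : Vector Carrier n} → (∀ i → f i ≈ g i) → sum f ≈ sum g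
  sum-cong = sum-cong-≋

  sum-zero : {f : Vector Carrier n} → (∀ i → f i ≈ 0#) → sum f ≈ 0#
  sum-zero {n} f≈0 = trans (sum-cong f≈0) (sum-replicate-zero n)

  sum-mono-≤ : {f g : Vector Carrier n} → (∀ i → f i ≤ g i) → sum f ≤ sum g
  sum-mono-≤ {zero}  f≤g = ≤-refl
  sum-mono-≤ {suc n} f≤g = +-mono-≤ (f≤g zero) (sum-mono-≤ (λ i → f≤g (suc i)))

  sum-nonneg : {f : Vector Carrier n} → (∀ i → 0# ≤ f i) → 0# ≤ sum f
  sum-nonneg {n} 0≤f = ≤-respˡ-≈ (sum-replicate-zero n) (sum-mono-≤ {f = λ _ → 0#} 0≤f)

  sum-pos : {f : Vector Carrier n} → (∀ i → 0# ≤ f i) → ∀ i → 0# < f i → 0# < sum f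
  sum-pos 0≤f zero    0<fi = +-pos-nonneg 0<fi (sum-nonneg (λ i → 0≤f (suc i)))
  sum-pos 0≤f (suc i) 0<fi = <-respʳ-≈ (+-comm _ _)
    (+-pos-nonneg (sum-pos (λ i → 0≤f (suc i)) i 0<fi) (0≤f zero))

  sum≈0⇒≈0 : {f : Vector Carrier n} → (∀ i → 0# ≤ f i) → sum f ≈ 0# → ∀ i → f i ≈ 0#
  sum≈0⇒≈0 0≤f ∑≈0 i with 0≤f i
  ... | inj₁ 0<fi = contradiction (sum-pos 0≤f i 0<fi) (irrefl (sym ∑≈0))
  ... | inj₂ 0≈fi = sym 0≈fi

  sum-linear : ∀ x y (f g : Vector Carrier n) →
               sum (λ i → x * f i + y * g i) ≈ x * sum f + y * sum g
  sum-linear x y f g = begin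
    sum (λ i → x * f i + y * g i)                  ≈⟨ ∑-distrib-+ (λ i → x * f i) (λ i → y * g i) ⟩
    sum (λ i → x * f i) + sum (λ i → y * g i)      ≈⟨ +-cong (*-distribˡ-sum x f) (*-distribˡ-sum y g) ⟨
    x * sum f + y * sum g                          ∎

  sum-sub : ∀ (f g : Vector Carrier n) → sum (λ i → f i - g i) ≈ sum f - sum g
  sum-sub {n} f g = begin
    sum (λ i → f i - g i)                   ≈⟨ solve 2 (λ x y → x := (x :+ y) :- y) refl _ (sum g) ⟩
    sum (λ i → f i - g i) + sum g - sum g   ≈⟨ +-congʳ (∑-distrib-+ (λ i → f i - g i) g) ⟨
    sum (λ i → f i - g i + g i) - sum g     ≈⟨ +-congʳ (sum-cong λ i → solve 2 (λ x y → x :- y :+ y := x) refl (f i) (g i)) ⟩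
    sum f - sum g                           ∎

  ⁺⁻¹-cong : x ≈ y → x ⁺⁻¹ ≈ y ⁺⁻¹
  ⁺⁻¹-cong {x} {y} x≈y with compare x 0# | compare y 0#
  ... | tri< _ _ _ | tri< _ _ _ = refl
  ... | tri< _ _ _ | tri≈ _ _ _ = refl
  ... | tri≈ _ _ _ | tri< _ _ _ = refl
  ... | tri≈ _ _ _ | tri≈ _ _ _ = refl
  ... | tri< _ _ 0≮x | tri> _ _ 0<y = contradiction (<-respʳ-≈ (sym x≈y) 0<y) 0≮x
  ... | tri≈ _ _ 0≮x | tri> _ _ 0<y = contradiction (<-respʳ-≈ (sym x≈y) 0<y) 0≮x
  ... | tri> _ _ 0<x | tri< _ _ 0≮y = contradiction (<-respʳ-≈ x≈y 0<x) 0≮y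
  ... | tri> _ _ 0<x | tri≈ _ _ 0≮y = contradiction (<-respʳ-≈ x≈y 0<x) 0≮y
  ... | tri> _ x≉0 _ | tri> _ y≉0 _ = begin
    x′               ≈⟨ *-identityʳ x′ ⟨
    x′ * 1#          ≈⟨ *-congˡ (proj₂ (inverse y y≉0)) ⟨
    x′ * (y * y′)    ≈⟨ *-congˡ (*-congʳ x≈y) ⟨
    x′ * (x * y′)    ≈⟨ solve 3 (λ a b c → a :* (b :* c) := (b :* a) :* c) refl x′ x y′ ⟩
    (x * x′) * y′    ≈⟨ *-congʳ (proj₂ (inverse x x≉0)) ⟩
    1# * y′          ≈⟨ *-identityˡ y′ ⟩
    y′               ∎
    where
    x′ = proj₁ (inverse x x≉0)
    y′ = proj₁ (inverse y y≉0)

-- The Fredholm alternative.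

module LinearAlgebra {c ℓ} (ℝ : CompleteOrderedField c ℓ) where
  open OrderedField ℝ
  open SetoidReasoning setoid

  private variable
    k : ℕ

  infixl 7 _∙_
  _∙_ : Vector Carrier n → Vector Carrier n → Carrier
  u ∙ v = sum (λ i → u i * v i)

  comb : Carrier → Vector Carrier n → Carrier → Vector Carrier n → Vector Carrier n
  comb p u q v i = p * u i + q * v i

  ∙-comm : ∀ (u v : Vector Carrier n) → u ∙ v ≈ v ∙ u
  ∙-comm u v = sum-cong λ i → *-comm (u i) (v i)

  ∙-combʳ : ∀ (w : Vector Carrier n) p u q v → w ∙ comb p u q v ≈ p * (w ∙ u) + q * (w ∙ v)
  ∙-combʳ {n} w p u q v = trans
    (sum-cong λ i → solve 5 (λ w p u q v → w :* (p :* u :+ q :* v) := p :* (w :* u) :+ q :* (w :* v))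
                            refl (w i) p (u i) q (v i))
    (sum-linear {n} p q _ _)

  ∙-combˡ : ∀ (w : Vector Carrier n) p u q v → comb p u q v ∙ w ≈ p * (u ∙ w) + q * (v ∙ w)
  ∙-combˡ w p u q v = trans (∙-comm _ w) (trans (∙-combʳ w p u q v)
    (+-cong (*-congˡ (∙-comm w u)) (*-congˡ (∙-comm w v))))

  δ : Fin n → Fin n → Carrier
  δ zero    zero    = 1#
  δ zero    (suc _) = 0#
  δ (suc _) zero    = 0#
  δ (suc i) (suc j) = δ i j

  δ-∙ : ∀ i (v : Vector Carrier n) → δ i ∙ v ≈ v i
  δ-∙ {suc n} zero v = begin
    1# * v zero + sum (λ i → 0# * v (suc i))    ≈⟨ +-cong (*-identityˡ _) (sum-zero {n} λ i → zeroˡ _) ⟩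
    v zero + 0#                                 ≈⟨ +-identityʳ _ ⟩
    v zero                                      ∎
  δ-∙ (suc i) v = begin
    0# * v zero + δ i ∙ (λ j → v (suc j))    ≈⟨ +-cong (zeroˡ _) (δ-∙ i (λ j → v (suc j))) ⟩
    0# + v (suc i)                           ≈⟨ +-identityˡ _ ⟩
    v (suc i)                                ∎

  δ-sym : ∀ (i j : Fin n) → δ i j ≈ δ j i
  δ-sym zero    zero    = refl
  δ-sym zero    (suc j) = refl
  δ-sym (suc i) zero    = refl
  δ-sym (suc i) (suc j) = δ-sym i j

  -- Elimination, one column at a time. If the obstruction `κ` for the remaining columns does not
  -- kill the new column `c₀`, that column is used to remove the obstruction from `b`, and the
  -- smaller system is solved again.
  fredholm : (C : Fin k → Vector Carrier n) (b : Vector Carrier n) →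
             (∃ λ (w : Vector Carrier k) → ∀ i → w ∙ (λ j → C j i) ≈ b i) ⊎
             (∃ λ (κ : Vector Carrier n) → (∀ j → κ ∙ C j ≈ 0#) × ¬ κ ∙ b ≈ 0#)
  fredholm {zero} C b with Finₚ.any? (λ i → ¬? (b i ≟ 0#))
  ... | yes (i , bᵢ≉0) = inj₂ (δ i , (λ ()) , λ δ∙b≈0 → bᵢ≉0 (trans (sym (δ-∙ i b)) δ∙b≈0))
  ... | no  ∄          = inj₁ ((λ ()) , λ i → sym (decidable-stable (b i ≟ 0#) (λ bᵢ≉0 → ∄ (i , bᵢ≉0))))
  fredholm {suc k} C b with fredholm (λ j → C (suc j)) b
  ... | inj₁ (w , eq) = inj₁ ((λ { zero → 0# ; (suc j) → w j }) ,
          λ i → trans (+-cong (zeroˡ _) (eq i)) (+-identityˡ _))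
  ... | inj₂ (κ , κ⊥ , κ∙b≉0) with (κ ∙ C zero) ≟ 0#
  ...   | yes κ∙c≈0 = inj₂ (κ , (λ { zero → κ∙c≈0 ; (suc j) → κ⊥ j }) , κ∙b≉0)
  ...   | no  κ∙c≉0 = reduce (fredholm (λ j → C (suc j)) b′)
    where
    c₀ = C zero
    y  = proj₁ (inverse (κ ∙ c₀) κ∙c≉0)
    yκc≈1 : (κ ∙ c₀) * y ≈ 1#
    yκc≈1 = proj₂ (inverse (κ ∙ c₀) κ∙c≉0)
    -- Chosen so that `κ` vanishes on `b′`; a solution for `b′` becomes one for `b` with coefficient
    -- `t` at `c₀`.
    t  = (κ ∙ b) * y
    b′ = comb 1# b (- t) c₀
    reduce : (∃ λ (w : Vector Carrier k) → ∀ i → w ∙ (λ j → C (suc j) i) ≈ b′ i) ⊎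
             (∃ λ (κ : Vector Carrier _) → (∀ j → κ ∙ C (suc j) ≈ 0#) × ¬ κ ∙ b′ ≈ 0#) → _
    reduce (inj₁ (w , eq)) = inj₁ ((λ { zero → t ; (suc j) → w j }) , λ i → begin
      t * c₀ i + sum (λ j → w j * C (suc j) i)    ≈⟨ +-congˡ (eq i) ⟩
      t * c₀ i + (1# * b i + - t * c₀ i)          ≈⟨ +-congˡ (+-congʳ (*-identityˡ _)) ⟩
      t * c₀ i + (b i + - t * c₀ i)               ≈⟨ solve 3 (λ t c b → t :* c :+ (b :+ :- t :* c) := b) refl t (c₀ i) (b i) ⟩
      b i                                         ∎)
    reduce (inj₂ (κ′ , κ′⊥ , κ′∙b′≉0)) = inj₂ (κ″ , (λ { zero → κ″∙c≈0 ; (suc j) → κ″⊥ j }) , λ κ″∙b≈0 → κ′∙b′≉0 (trans κ′∙b′≈κ″∙b κ″∙b≈0))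
      where
      -- Chosen so that `κ″` vanishes on `c₀`. The corrections by `t` and `s` are adjoint to each
      -- other, whence `κ′ ∙ b′ ≈ κ″ ∙ b`.
      s  = (κ′ ∙ c₀) * y
      κ″ = comb 1# κ′ (- s) κ
      κ″⊥ : ∀ j → κ″ ∙ C (suc j) ≈ 0#
      κ″⊥ j = begin
        κ″ ∙ C (suc j)                                  ≈⟨ ∙-combˡ (C (suc j)) 1# κ′ (- s) κ ⟩
        1# * (κ′ ∙ C (suc j)) + - s * (κ ∙ C (suc j))   ≈⟨ +-cong (*-congˡ (κ′⊥ j)) (*-congˡ (κ⊥ j)) ⟩
        1# * 0# + - s * 0#                              ≈⟨ solve 2 (λ o s → o :* :0 :+ s :* :0 := :0) refl 1# (- s) ⟩
        0#                                              ∎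
      κ″∙c≈0 : κ″ ∙ c₀ ≈ 0#
      κ″∙c≈0 = begin
        κ″ ∙ c₀                                             ≈⟨ ∙-combˡ c₀ 1# κ′ (- s) κ ⟩
        1# * (κ′ ∙ c₀) + - s * (κ ∙ c₀)                     ≈⟨ solve 4 (λ o p y q → o :* p :+ :- (p :* y) :* q := p :* (o :- q :* y)) refl 1# (κ′ ∙ c₀) y (κ ∙ c₀) ⟩
        (κ′ ∙ c₀) * (1# - (κ ∙ c₀) * y)                     ≈⟨ *-congˡ (+-congˡ (-‿cong yκc≈1)) ⟩
        (κ′ ∙ c₀) * (1# - 1#)                               ≈⟨ solve 2 (λ p o → p :* (o :- o) := :0) refl (κ′ ∙ c₀) 1# ⟩
        0#                                                  ∎
      κ′∙b′≈κ″∙b : κ′ ∙ b′ ≈ κ″ ∙ b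
      κ′∙b′≈κ″∙b = begin
        κ′ ∙ b′                                 ≈⟨ ∙-combʳ κ′ 1# b (- t) c₀ ⟩
        1# * (κ′ ∙ b) + - t * (κ′ ∙ c₀)         ≈⟨ +-congˡ (solve 3 (λ p y q → :- (p :* y) :* q := :- (q :* y) :* p) refl (κ ∙ b) y (κ′ ∙ c₀)) ⟩
        1# * (κ′ ∙ b) + - s * (κ ∙ b)           ≈⟨ ∙-combˡ b 1# κ′ (- s) κ ⟨
        κ″ ∙ b                                  ∎

  -- Symmetric forms with one positive direction.

  module SymmetricForm (H : Fin n → Fin n → Carrier) (H-sym : ∀ i j → H i j ≈ H j i) where

    row : Vector Carrier n → Vector Carrier n
    row v i = H i ∙ v

    form : Vector Carrier n → Vector Carrier n → Carrier
    form u v = u ∙ row v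

    row-cong : ∀ {u v} → (∀ i → u i ≈ v i) → ∀ i → row u i ≈ row v i
    row-cong u≈v i = sum-cong λ j → *-congˡ (u≈v j)

    form-cong : ∀ {u u′ v v′} → (∀ i → u i ≈ u′ i) → (∀ i → v i ≈ v′ i) → form u v ≈ form u′ v′
    form-cong u≈u′ v≈v′ = sum-cong λ i → *-cong (u≈u′ i) (row-cong v≈v′ i)

    form-comm : ∀ u v → form u v ≈ form v u
    form-comm u v = begin
      sum (λ i → u i * sum (λ j → H i j * v j))     ≈⟨ sum-cong (λ i → *-distribˡ-sum (u i) (λ j → H i j * v j)) ⟩
      sum (λ i → sum (λ j → u i * (H i j * v j)))   ≈⟨ ∑-comm (λ i j → u i * (H i j * v j)) ⟩
      sum (λ j → sum (λ i → u i * (H i j * v j)))   ≈⟨ (sum-cong λ j → sum-cong λ i → trans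
                                                         (solve 3 (λ u h v → u :* (h :* v) := v :* (h :* u)) refl (u i) (H i j) (v j))
                                                         (*-congˡ (*-congʳ (H-sym i j)))) ⟩
      sum (λ j → sum (λ i → v j * (H j i * u i)))   ≈⟨ sum-cong (λ j → *-distribˡ-sum (v j) (λ i → H j i * u i)) ⟨
      form v u                                      ∎

    form-combˡ : ∀ w p u q v → form (comb p u q v) w ≈ p * form u w + q * form v w
    form-combˡ w = ∙-combˡ (row w)

    form-combʳ : ∀ w p u q v → form w (comb p u q v) ≈ p * form w u + q * form w v
    form-combʳ w p u q v = trans (sum-cong λ i → *-congˡ (∙-combʳ (H i) p u q v)) (∙-combʳ w p (row u) q (row v))

    form-comb² : ∀ p u q v → form (comb p u q v) (comb p u q v) ≈
                 p * p * form u u + (p * q * form u v + p * q * form u v) + q * q * form v v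
    form-comb² p u q v = begin
      form (comb p u q v) (comb p u q v)                                        ≈⟨ form-combˡ (comb p u q v) p u q v ⟩
      p * form u (comb p u q v) + q * form v (comb p u q v)                     ≈⟨ +-cong (*-congˡ (form-combʳ u p u q v)) (*-congˡ (form-combʳ v p u q v)) ⟩
      p * (p * form u u + q * form u v) + q * (p * form v u + q * form v v)     ≈⟨ +-congˡ (*-congˡ (+-congʳ (*-congˡ (form-comm v u)))) ⟩
      p * (p * form u u + q * form u v) + q * (p * form u v + q * form v v)     ≈⟨ solve 5 (λ p q uu uv vv →
          p :* (p :* uu :+ q :* uv) :+ q :* (p :* uv :+ q :* vv) :=
          p :* p :* uu :+ (p :* q :* uv :+ p :* q :* uv) :+ q :* q :* vv) refl p q (form u u) (form u v) (form v v) ⟩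
      p * p * form u u + (p * q * form u v + p * q * form u v) + q * q * form v v ∎

    -- Together with `0# < form a a` this says that the form has exactly one positive direction.
    NegativeOnComplement : Vector Carrier n → Set _
    NegativeOnComplement a = ∀ v → form a v ≈ 0# → form v v ≤ 0#

    private
      project⊥ : ∀ a v → form a (comb (form a a) v (- form a v) a) ≈ 0#
      project⊥ a v = trans (form-combʳ a (form a a) v (- form a v) a)
        (solve 2 (λ x y → x :* y :+ :- y :* x := :0) refl (form a a) (form a v))

    -- Evaluate the form at the projection of `v` to the complement of `a`, scaled by `form a a` so
    -- that no division occurs.
    reverse-cauchy-schwarz : ∀ {a} → 0# < form a a → NegativeOnComplement a →
                             ∀ v → form a a * form v v ≤ form a v * form a v
    reverse-cauchy-schwarz {a} 0<aa nsd v =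
      0≤-⇒≤ (*-cancel-0≤ 0<aa (≤-respʳ-≈ eq (-‿nonpos (nsd v′ (project⊥ a v)))))
      where
      s = form a a
      b = form a v
      v′ = comb s v (- b) a
      eq : - form v′ v′ ≈ s * (b * b - s * form v v)
      eq = begin
        - form v′ v′                                                             ≈⟨ -‿cong (form-comb² s v (- b) a) ⟩
        - (s * s * form v v + (s * - b * form v a + s * - b * form v a) + - b * - b * s)   ≈⟨ -‿cong (+-congʳ (+-congˡ (+-cong (*-congˡ (form-comm v a)) (*-congˡ (form-comm v a))))) ⟩
        - (s * s * form v v + (s * - b * b + s * - b * b) + - b * - b * s)       ≈⟨ solve 3 (λ s b vv →
            :- (s :* s :* vv :+ (s :* :- b :* b :+ s :* :- b :* b) :+ :- b :* :- b :* s) := s :* (b :* b :- s :* vv)) refl s b (form v v) ⟩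
        s * (b * b - s * form v v)                                               ∎

    -- An isotropic vector of a semidefinite form lies in its radical. The test vector `u` is the
    -- scaled projection of the unit vector `δ i`; as `form a v` vanishes, its pairing with `v` is
    -- `form a a * row v i`.
    isotropic⇒null : ∀ {a} → 0# < form a a → NegativeOnComplement a →
                     ∀ {v} → form a v ≈ 0# → form v v ≈ 0# → ∀ i → row v i ≈ 0#
    isotropic⇒null {a} 0<aa nsd {v} av≈0 vv≈0 i = trans (sym (δ-∙ i (row v))) (*-cancel-≈0 0<aa (trans (sym eq) β≈0))
      where
      u = comb (form a a) (δ i) (- form a (δ i)) a
      β = form u v
      γ = form u u
      eq : β ≈ form a a * form (δ i) v
      eq = trans (form-combˡ v (form a a) (δ i) (- form a (δ i)) a)
             (trans (+-congˡ (*-congˡ av≈0))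
               (solve 2 (λ x y → x :+ y :* :0 := x) refl _ _))
      a⊥u : form a u ≈ 0#
      a⊥u = project⊥ a (δ i)
      -- The value of the form at (1 − γ)v + βu is β²(2 − γ), and 2 − γ > 0.
      p = 1# - γ
      z = comb p v β u
      az≈0 : form a z ≈ 0#
      az≈0 = begin
        form a z                         ≈⟨ form-combʳ a p v β u ⟩
        p * form a v + β * form a u      ≈⟨ +-cong (*-congˡ av≈0) (*-congˡ a⊥u) ⟩
        p * 0# + β * 0#                  ≈⟨ solve 2 (λ p b → p :* :0 :+ b :* :0 := :0) refl p β ⟩
        0#                               ∎
      zz≈ : form z z ≈ (1# + (1# - γ)) * (β * β)
      zz≈ = begin
        form z z                                                              ≈⟨ form-comb² p v β u ⟩
        p * p * form v v + (p * β * form v u + p * β * form v u) + β * β * γ  ≈⟨ +-congʳ (+-cong (*-congˡ vv≈0) (+-cong (*-congˡ (form-comm v u)) (*-congˡ (form-comm v u)))) ⟩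
        p * p * 0# + (p * β * β + p * β * β) + β * β * γ                      ≈⟨ solve 3 (λ o b g →
            (o :- g) :* (o :- g) :* :0 :+ ((o :- g) :* b :* b :+ (o :- g) :* b :* b) :+ b :* b :* g
            := (o :+ (o :- g)) :* (b :* b)) refl 1# β γ ⟩
        (1# + (1# - γ)) * (β * β)                                             ∎
      0<2-γ : 0# < 1# + (1# - γ)
      0<2-γ = +-pos-nonneg 0<1 (inj₁ (+-pos-nonneg 0<1 (-‿nonpos (nsd u a⊥u))))
      β≈0 : β ≈ 0#
      β≈0 = ²≈0⇒≈0 (*-cancel-≈0 0<2-γ (≤-antisym
        (≤-respˡ-≈ zz≈ (nsd z az≈0))
        (*-nonneg (inj₁ 0<2-γ) (0≤² β))))

    -- Dirichlet energy of `r` on the graph with edge weights `H i j * (a i * a j)`. Summing over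
    -- ordered pairs counts each edge twice, hence the two copies of `Y - form u u`.
    laplacian : ∀ (a r : Vector Carrier n) → let u = λ i → a i * r i ; Y = sum (λ i → a i * (row a i * (r i * r i))) in
                sum (λ i → sum (λ j → H i j * (a i * a j) * ((r i - r j) * (r i - r j)))) ≈
                (Y - form u u) + (Y - form u u)
    laplacian a r = begin
      sum (λ i → sum (λ j → H i j * (a i * a j) * ((r i - r j) * (r i - r j))))
        ≈⟨ (sum-cong λ i → sum-cong λ j → trans
             (solve 6 (λ h g a b r s → h :* (a :* b) :* ((r :- s) :* (r :- s)) :=
                 (a :* (r :* r) :* (h :* b) :- a :* r :* (h :* (b :* s))) :+ (b :* (s :* s) :* (h :* a) :- b :* s :* (h :* (a :* r))))
               refl (H i j) (H j i) (a i) (a j) (r i) (r j))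
             (+-congˡ (+-cong (*-congˡ (*-congʳ (H-sym i j))) (-‿cong (*-congˡ (*-congʳ (H-sym i j))))))) ⟩
      sum (λ i → sum (λ j → F i j + F j i))                ≈⟨ (sum-cong λ i → ∑-distrib-+ (F i) (λ j → F j i)) ⟩
      sum (λ i → sum (F i) + sum (λ j → F j i))            ≈⟨ ∑-distrib-+ (λ i → sum (F i)) (λ i → sum (λ j → F j i)) ⟩
      sum (λ i → sum (F i)) + sum (λ i → sum (λ j → F j i)) ≈⟨ +-congˡ (∑-comm F) ⟨
      sum (λ i → sum (F i)) + sum (λ i → sum (F i))        ≈⟨ +-cong ∑F ∑F ⟩
      (Y - form u u) + (Y - form u u)                      ∎
      where
      u = λ i → a i * r i
      Y = sum (λ i → a i * (row a i * (r i * r i)))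
      F : Fin n → Fin n → Carrier
      F i j = a i * (r i * r i) * (H i j * a j) - a i * r i * (H i j * (a j * r j))
      ∑F : sum (λ i → sum (F i)) ≈ Y - form u u
      ∑F = begin
        sum (λ i → sum (F i))
          ≈⟨ (sum-cong λ i → trans (sum-sub {n} _ _) (+-cong
               (trans (sym (*-distribˡ-sum (a i * (r i * r i)) (λ j → H i j * a j)))
                      (solve 3 (λ a r h → a :* (r :* r) :* h := a :* (h :* (r :* r))) refl (a i) (r i) (row a i)))
               (-‿cong (sym (*-distribˡ-sum (a i * r i) (λ j → H i j * (a j * r j))))))) ⟩
        sum (λ i → a i * (row a i * (r i * r i)) - u i * row u i)
          ≈⟨ sum-sub {n} _ _ ⟩
        Y - form u u ∎

    -- The third hypothesis is H ≤ H D H. The fourth is connectedness of the graph in `laplacian`;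
    -- it speaks of `a j * r j` weighted by `H i j` because `r` is unconstrained where `a j` or the
    -- column of `j` vanishes.
    negative-on-complement : ∀ {a} → (∀ i j → 0# ≤ H i j) → (∀ i → 0# ≤ a i) →
      (∀ v → form v v ≤ sum (λ i → a i * (row a i ⁺⁻¹ * (row v i * row v i)))) →
      (∀ r → (∀ i j → H i j * (a i * a j) * ((r i - r j) * (r i - r j)) ≈ 0#) →
             ∃ λ c → ∀ i j → H i j * (a j * r j) ≈ c * (H i j * a j)) →
      NegativeOnComplement a
    negative-on-complement {a} 0≤H 0≤a bound harmonic⇒constant v av≈0 =
      -- The columns of 1 - D H. Where `ρ i` is zero, as at an element of weight zero, the equation
      -- just reads `w i ≈ v i`.
      solvable (fredholm (λ j i → δ i j - ρ i * H i j) v)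
      where
      ρ : Vector Carrier n
      ρ i = a i * row a i ⁺⁻¹

      -- The diagonal part `Y` of `laplacian` for `r` equal to `κ` divided by `row a`; `⁺⁻¹-idem`
      -- covers the entries where `row a` is zero.
      energy : ∀ (κ : Vector Carrier n) →
               sum (λ i → a i * (row a i * (row a i ⁺⁻¹ * κ i * (row a i ⁺⁻¹ * κ i)))) ≈
               sum (λ i → a i * (row a i ⁺⁻¹ * (κ i * κ i)))
      energy κ = sum-cong λ i → trans
        (solve 4 (λ a s p k → a :* (s :* (p :* k :* (p :* k))) := a :* (s :* (p :* p) :* (k :* k)))
                 refl (a i) (row a i) (row a i ⁺⁻¹) (κ i))
        (*-congˡ (*-congʳ (⁺⁻¹-idem (row a i))))

      -- Vanishing on every column of 1 - D H means κ = H D κ. For the quotient `r` of `κ` by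
      -- `row a` this is harmonicity under the random walk with steps `H i j * a j` divided by
      -- `row a i`.
      harmonic : ∀ κ → (∀ j → κ ∙ (λ i → δ i j - ρ i * H i j) ≈ 0#) →
                 ∀ j → κ j ≈ row (λ i → a i * (row a i ⁺⁻¹ * κ i)) j
      harmonic κ κ⊥ j = begin
        κ j                                                       ≈⟨ solve 2 (λ x y → x := (x :- y) :+ y) refl (κ j) _ ⟩
        κ j - row u j + row u j                                   ≈⟨ +-congʳ eq ⟩
        0# + row u j                                              ≈⟨ +-identityˡ _ ⟩
        row u j                                                   ∎
        where
        u : Vector Carrier n
        u i = a i * (row a i ⁺⁻¹ * κ i)
        eq : κ j - row u j ≈ 0#
        eq = begin
          κ j - row u j                                           ≈⟨ +-congʳ (δ-∙ j κ) ⟨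
          δ j ∙ κ - row u j                                       ≈⟨ sum-sub {n} _ _ ⟨
          sum (λ i → δ j i * κ i - H j i * u i)                   ≈⟨ (sum-cong λ i → trans
              (+-cong (*-congʳ (δ-sym j i)) (-‿cong (*-congʳ (H-sym j i))))
              (solve 5 (λ d k h a p → d :* k :- h :* (a :* (p :* k)) := k :* (d :- a :* p :* h))
                refl (δ i j) (κ i) (H i j) (a i) (row a i ⁺⁻¹))) ⟩
          κ ∙ (λ i → δ i j - ρ i * H i j)                         ≈⟨ κ⊥ j ⟩
          0#                                                      ∎

      solvable : _ → form v v ≤ 0#
      solvable (inj₂ (κ , κ⊥ , κ∙v≉0)) = contradiction κ∙v≈0 κ∙v≉0
        where
        r : Vector Carrier n
        r i = row a i ⁺⁻¹ * κ i
        u : Vector Carrier n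
        u i = a i * r i
        Y = sum (λ i → a i * (row a i * (r i * r i)))
        -- Harmonicity makes the Dirichlet energy of `r` zero, so each of its nonnegative terms is
        -- zero.
        Y≈uu : Y ≈ form u u
        Y≈uu = begin
          Y                                              ≈⟨ energy κ ⟩
          sum (λ i → a i * (row a i ⁺⁻¹ * (κ i * κ i)))  ≈⟨ (sum-cong λ i → solve 3 (λ a p k → a :* (p :* (k :* k)) := a :* (p :* k) :* k) refl (a i) (row a i ⁺⁻¹) (κ i)) ⟩
          sum (λ i → u i * κ i)                          ≈⟨ (sum-cong λ i → *-congˡ (harmonic κ κ⊥ i)) ⟩
          form u u                                       ∎
        term : Fin n → Fin n → Carrier
        term i j = H i j * (a i * a j) * ((r i - r j) * (r i - r j))
        0≤term : ∀ i j → 0# ≤ term i j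
        0≤term i j = *-nonneg (*-nonneg (0≤H i j) (*-nonneg (0≤a i) (0≤a j))) (0≤² _)
        ∑term≈0 : sum (λ i → sum (term i)) ≈ 0#
        ∑term≈0 = trans (laplacian a r) (trans (+-cong Y-uu≈0 Y-uu≈0) (+-identityˡ 0#))
          where
          Y-uu≈0 : Y - form u u ≈ 0#
          Y-uu≈0 = trans (+-congʳ Y≈uu) (-‿inverseʳ _)
        constant = harmonic⇒constant r λ i j →
          sum≈0⇒≈0 (0≤term i) (sum≈0⇒≈0 (λ i → sum-nonneg (0≤term i)) ∑term≈0 i) j
        c₀ = proj₁ constant
        κ≈ca : ∀ i → κ i ≈ c₀ * row a i
        κ≈ca i = trans (harmonic κ κ⊥ i) (trans (sum-cong (proj₂ constant i))
          (sym (*-distribˡ-sum c₀ (λ j → H i j * a j))))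
        κ∙v≈0 : κ ∙ v ≈ 0#
        κ∙v≈0 = begin
          κ ∙ v                                ≈⟨ sum-cong (λ i → trans (*-congʳ (κ≈ca i))
                                                    (solve 3 (λ c s v → c :* s :* v := c :* (v :* s)) refl c₀ (row a i) (v i))) ⟩
          sum (λ i → c₀ * (v i * row a i))     ≈⟨ *-distribˡ-sum c₀ (λ i → v i * row a i) ⟨
          c₀ * form v a                        ≈⟨ *-congˡ (trans (form-comm v a) av≈0) ⟩
          c₀ * 0#                              ≈⟨ zeroʳ c₀ ⟩
          0#                                   ∎
      solvable (inj₁ (w , eq)) = 0≤-⇒≤ (≤-respʳ-≈ (sym split) (+-nonneg (≤⇒0≤- X≤Y) 0≤Y-uu))
        where
        r : Vector Carrier n
        r i = row a i ⁺⁻¹ * row w i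
        u : Vector Carrier n
        u i = a i * r i
        X = form w w
        Y = sum (λ i → a i * (row a i ⁺⁻¹ * (row w i * row w i)))
        X≤Y : X ≤ Y
        X≤Y = bound w
        v≈w-u : ∀ i → v i ≈ comb 1# w (- 1#) u i
        v≈w-u i = begin
          v i                                                ≈⟨ eq i ⟨
          w ∙ (λ j → δ i j - ρ i * H i j)                    ≈⟨ (sum-cong λ j →
              solve 4 (λ w d p h → w :* (d :- p :* h) := d :* w :- p :* (h :* w)) refl (w j) (δ i j) (ρ i) (H i j)) ⟩
          sum (λ j → δ i j * w j - ρ i * (H i j * w j))      ≈⟨ sum-sub {n} _ _ ⟩
          δ i ∙ w - sum (λ j → ρ i * (H i j * w j))          ≈⟨ +-cong (δ-∙ i w) (-‿cong (sym (*-distribˡ-sum (ρ i) (λ j → H i j * w j)))) ⟩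
          w i - ρ i * row w i                                ≈⟨ solve 4 (λ w a p k → w :- a :* p :* k := :1 :* w :+ :- :1 :* (a :* (p :* k)))
                                                                  refl (w i) (a i) (row a i ⁺⁻¹) (row w i) ⟩
          comb 1# w (- 1#) u i                               ∎
        -- Here `u` is D H w, and `Y` is the value of H D H at `w`; so `Y` is also the cross term in
        -- the expansion at `w - u`.
        wu≈Y : form w u ≈ Y
        wu≈Y = trans (form-comm w u) (sum-cong λ i →
          solve 3 (λ a p k → a :* (p :* k) :* k := a :* (p :* (k :* k))) refl (a i) (row a i ⁺⁻¹) (row w i))
        split : 0# - form v v ≈ (Y - X) + (Y - form u u)
        split = begin
          0# - form v v                                                       ≈⟨ +-congˡ (-‿cong (trans (form-cong v≈w-u v≈w-u) (form-comb² 1# w (- 1#) u))) ⟩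
          0# - (1# * 1# * X + (1# * - 1# * form w u + 1# * - 1# * form w u) + - 1# * - 1# * form u u)
                                                                              ≈⟨ +-congˡ (-‿cong (+-congʳ (+-congˡ (+-cong (*-congˡ wu≈Y) (*-congˡ wu≈Y))))) ⟩
          0# - (1# * 1# * X + (1# * - 1# * Y + 1# * - 1# * Y) + - 1# * - 1# * form u u)
                                                                              ≈⟨ solve 3 (λ x y u → :0 :- (:1 :* :1 :* x :+ (:1 :* :- :1 :* y :+ :1 :* :- :1 :* y) :+ :- :1 :* :- :1 :* u)
                                                                                   := (y :- x) :+ (y :- u)) refl X Y (form u u) ⟩
          (Y - X) + (Y - form u u)                                            ∎
        0≤Y-uu : 0# ≤ Y - form u u
        0≤Y-uu = *-cancel-0≤ (+-pos-nonneg 0<1 (inj₁ 0<1)) (≤-respʳ-≈ double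
          (sum-nonneg λ i → sum-nonneg λ j → *-nonneg (*-nonneg (0≤H i j) (*-nonneg (0≤a i) (0≤a j))) (0≤² (r i - r j))))
          where
          double : sum (λ i → sum (λ j → H i j * (a i * a j) * ((r i - r j) * (r i - r j)))) ≈ (1# + 1#) * (Y - form u u)
          double = trans (laplacian a r) (trans
            (+-cong (+-congʳ (energy (row w))) (+-congʳ (energy (row w))))
            (solve 1 (λ x → x :+ x := (:1 :+ :1) :* x) refl (Y - form u u)))

-- Exponents as iterated derivatives, and indicator vectors of subsets.

inc : Fin n → Exponent n → Exponent n
inc i α = updateAt α i suc

inc-comm : ∀ (i j : Fin n) α → inc i (inc j α) ≡ inc j (inc i α)
inc-comm zero    zero    (k ∷ α) = ≡.refl
inc-comm zero    (suc j) (k ∷ α) = ≡.refl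
inc-comm (suc i) zero    (k ∷ α) = ≡.refl
inc-comm (suc i) (suc j) (k ∷ α) = cong (k ∷_) (inc-comm i j α)

inc-rotate : ∀ (i j l : Fin n) α → inc l (inc i (inc j α)) ≡ inc i (inc j (inc l α))
inc-rotate i j l α = ≡.trans (inc-comm l i (inc j α)) (cong (inc i) (inc-comm l j α))

sum-inc : ∀ (i : Fin n) α → Vec.sum (inc i α) ≡ suc (Vec.sum α)
sum-inc zero    (k ∷ α) = ≡.refl
sum-inc (suc i) (k ∷ α) = ≡.trans (cong (k ℕ.+_) (sum-inc i α)) (ℕₚ.+-suc k _)

sum-suc⇒inc : ∀ {k} (γ : Exponent n) → Vec.sum γ ≡ suc k → ∃ λ i → ∃ λ γ′ → γ ≡ inc i γ′ × Vec.sum γ′ ≡ k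
sum-suc⇒inc (suc m ∷ γ) eq = zero , m ∷ γ , ≡.refl , ℕₚ.suc-injective eq
sum-suc⇒inc (zero  ∷ γ) eq = let (i , γ′ , γ≡ , Σ≡) = sum-suc⇒inc γ eq in suc i , 0 ∷ γ′ , cong (0 ∷_) γ≡ , Σ≡

sum-indicator : ∀ (I : Subset n) → Vec.sum (indicator I) ≡ ∣ I ∣
sum-indicator []            = ≡.refl
sum-indicator (inside  ∷ I) = cong suc (sum-indicator I)
sum-indicator (outside ∷ I) = sum-indicator I

inc-indicator : ∀ {x : Fin n} I → x ∉ I → inc x (indicator I) ≡ indicator (I ∪ ⁅ x ⁆)
inc-indicator {x = zero}  (inside  ∷ I) x∉I = contradiction Vec.here x∉I
inc-indicator {x = zero}  (outside ∷ I) x∉I = cong (λ J → 1 ∷ indicator J) (≡.sym (Subsetₚ.∪-identityʳ I))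
inc-indicator {x = suc x} (inside  ∷ I) x∉I = cong (1 ∷_) (inc-indicator I (λ x∈I → x∉I (Vec.there x∈I)))
inc-indicator {x = suc x} (outside ∷ I) x∉I = cong (0 ∷_) (inc-indicator I (λ x∈I → x∉I (Vec.there x∈I)))

inc≡indicator : ∀ {x : Fin n} {γ} J → inc x γ ≡ indicator J → x ∈ J × γ ≡ indicator (J Subset.- x)
inc≡indicator {x = zero} {m ∷ γ} (inside ∷ J) eq =
  Vec.here , cong₂ _∷_ (ℕₚ.suc-injective (Vecₚ.∷-injectiveˡ eq))
                       (≡.trans (Vecₚ.∷-injectiveʳ eq) (cong indicator (≡.sym (Subsetₚ.p─⊥≡p J))))
inc≡indicator {x = zero} {m ∷ γ} (outside ∷ J) eq = contradiction (Vecₚ.∷-injectiveˡ eq) (λ ())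
inc≡indicator {x = suc x} {m ∷ γ} (b ∷ J) eq with inc≡indicator J (Vecₚ.∷-injectiveʳ eq)
... | x∈J , γ≡ = Vec.there x∈J , cong₂ _∷_ (Vecₚ.∷-injectiveˡ eq) γ≡

∈⇒indicator≡1 : ∀ {x : Fin n} {I} → x ∈ I → lookup (indicator I) x ≡ 1
∈⇒indicator≡1 {x = x} {I} x∈I = ≡.trans (Vecₚ.lookup-map x _ I) (cong (λ b → if b then 1 else 0) (Vecₚ.[]=⇒lookup x∈I))

∉⇒indicator≡0 : ∀ {x : Fin n} {I} → x ∉ I → lookup (indicator I) x ≡ 0
∉⇒indicator≡0 {x = x} {I} x∉I with lookup I x in eq
... | true  = contradiction (Vecₚ.lookup⇒[]= x I eq) x∉I
... | false = ≡.trans (Vecₚ.lookup-map x _ I) (cong (λ b → if b then 1 else 0) eq)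

lookup-inc-≢ : ∀ {x y : Fin n} α → x ≢ y → lookup (inc y α) x ≡ lookup α x
lookup-inc-≢ {x = x} {y} α x≢y = Vecₚ.lookup∘updateAt′ x y x≢y α

lookup≤inc : ∀ (x y : Fin n) α → lookup α x ℕ.≤ lookup (inc y α) x
lookup≤inc x y α with x Finₚ.≟ y
... | yes ≡.refl rewrite Vecₚ.lookup∘updateAt x {suc} α = ℕₚ.n≤1+n _
... | no  x≢y    = ℕₚ.≤-reflexive (≡.sym (lookup-inc-≢ α x≢y))

subsets-complete : ∀ (I : Subset n) → I ∈ˡ subsets n
subsets-complete []            = here ≡.refl
subsets-complete (inside  ∷ I) = ∈-++⁺ˡ (∈-map⁺ (inside ∷_) (subsets-complete I))
subsets-complete {suc n} (outside ∷ I) = ∈-++⁺ʳ (map (inside ∷_) (subsets n)) (∈-map⁺ (outside ∷_) (subsets-complete I))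

-- Matroid axioms on exponents.

module MatroidProperties (M : Matroid n) where
  open Matroid M

  indep⇒∣∣≤rank : ∀ {I} → Indep I → ∣ I ∣ ℕ.≤ rank M
  indep⇒∣∣≤rank {I} indI = All.lookup (xs≤max 0 (map ∣_∣ (filter Indep? (subsets n))))
    (∈-map⁺ ∣_∣ (∈-filter⁺ Indep? (subsets-complete I) indI))

  rank-attained : ∃ λ I → Indep I × ∣ I ∣ ≡ rank M
  rank-attained with Extrema.argmax-sel ℕₚ.≤-totalOrder (λ k → k) 0 (map ∣_∣ (filter Indep? (subsets n)))
  ... | inj₁ max≡0 = Subset.⊥ , empty , ≡.trans (Subsetₚ.∣⊥∣≡0 n) (≡.sym max≡0)
  ... | inj₂ max∈  with ∈-map⁻ ∣_∣ max∈
  ...   | I , I∈ , eq = I , proj₂ (∈-filter⁻ Indep? {xs = subsets n} I∈) , ≡.sym eq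

  basis⇒∣∣≡rank : ∀ {B} → Basis M B → ∣ B ∣ ≡ rank M
  basis⇒∣∣≡rank {B} (indB , maximal) with ℕₚ.m≤n⇒m<n∨m≡n (indep⇒∣∣≤rank indB)
  ... | inj₂ eq = eq
  ... | inj₁ ∣B∣<rank with rank-attained
  ...   | I , indI , ∣I∣≡rank with augmentation indB indI (≡.subst (∣ B ∣ ℕ.<_) (≡.sym ∣I∣≡rank) ∣B∣<rank)
  ...     | x , _ , x∉B , indB∪x = contradiction
              (B ∪ ⁅ x ⁆ , indB∪x , (λ {_} → Subsetₚ.p⊆p∪q ⁅ x ⁆) , x , Subsetₚ.q⊆p∪q B ⁅ x ⁆ (Subsetₚ.x∈⁅x⁆ x) , x∉B) maximal

  ∣∣≡rank⇒basis : ∀ {B} → Indep B → ∣ B ∣ ≡ rank M → Basis M B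
  ∣∣≡rank⇒basis indB ∣B∣≡rank = indB , λ (J , indJ , B⊂J) → ℕₚ.<⇒≱ (Subsetₚ.p⊂q⇒∣p∣<∣q∣ B⊂J)
    (≡.subst (∣ J ∣ ℕ.≤_) (≡.sym ∣B∣≡rank) (indep⇒∣∣≤rank indJ))

  -- Exponents with a repeated element count as dependent, which records that all ∂_i² annihilate
  -- `f_M`.
  Independent : Pred (Exponent n) _
  Independent γ = ∃ λ I → Indep I × indicator I ≡ γ

  Independent? : Decidable Independent
  Independent? γ = Subsetₚ.anySubset? (λ I → Indep? I ×-dec (indicator I ≟ᴱ γ))

  isBasis? : ∀ γ → Dec (Independent γ × Vec.sum γ ≡ rank M)
  isBasis? γ = Independent? γ ×-dec (Vec.sum γ ℕₚ.≟ rank M)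

  independent-hereditary : ∀ {i γ} → Independent (inc i γ) → Independent γ
  independent-hereditary {i} (J , indJ , eq) with inc≡indicator J (≡.sym eq)
  ... | _ , γ≡ = J Subset.- i , hereditary (Subsetₚ.p─q⊆p J ⁅ i ⁆) indJ , ≡.sym γ≡

  independent⇒≤1 : ∀ {γ} → Independent γ → ∀ x → lookup γ x ℕ.≤ 1
  independent⇒≤1 (I , _ , ≡.refl) x with x Subsetₚ.∈? I
  ... | yes x∈I = ℕₚ.≤-reflexive (∈⇒indicator≡1 x∈I)
  ... | no  x∉I = ℕₚ.≤-trans (ℕₚ.≤-reflexive (∉⇒indicator≡0 x∉I)) z≤n

  ¬independent-inc² : ∀ i γ → ¬ Independent (inc i (inc i γ))
  ¬independent-inc² i γ ind = contradiction
    (≡.subst (ℕ._≤ 1) (≡.trans (Vecₚ.lookup∘updateAt i (inc i γ)) (cong suc (Vecₚ.lookup∘updateAt i γ)))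
      (independent⇒≤1 ind i))
    λ { (s≤s ()) }

  augment : ∀ {I γ} → Indep I → Independent γ → Vec.sum γ ℕ.< ∣ I ∣ →
            ∃ λ x → x ∈ I × lookup γ x ≡ 0 × Independent (inc x γ)
  augment {I} indI (J , indJ , ≡.refl) ∣J∣<∣I∣
    with augmentation indJ indI (≡.subst (ℕ._< ∣ I ∣) (sum-indicator J) ∣J∣<∣I∣)
  ... | x , x∈I , x∉J , indJ∪x = x , x∈I , ∉⇒indicator≡0 x∉J , J ∪ ⁅ x ⁆ , indJ∪x , ≡.sym (inc-indicator J x∉J)

  -- Augment `inc x γ` from the set of `inc y (inc j γ)`, which has one element more: the new
  -- element is not in `γ`, so it is `y` or `j`. This gives both the transitivity of parallelism and
  -- the connectedness of the weighted graph.
  independent-exchange : ∀ {x y j γ} → Independent (inc x γ) → Independent (inc y (inc j γ)) →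
                         Independent (inc y (inc x γ)) ⊎ Independent (inc j (inc x γ))
  independent-exchange {x} {y} {j} {γ} indx (I , indI , eq) with augment indI indx
    (ℕₚ.≤-reflexive (≡.trans (cong suc (≡.trans (sum-inc x γ) (≡.sym (sum-inc j γ))))
      (≡.trans (≡.sym (sum-inc y (inc j γ))) (≡.trans (cong Vec.sum (≡.sym eq)) (sum-indicator I)))))
  ... | z , z∈I , z∉ , indz with z Finₚ.≟ y | z Finₚ.≟ j
  ...   | yes ≡.refl | _          = inj₁ indz
  ...   | no  _      | yes ≡.refl = inj₂ indz
  ...   | no  z≢y    | no  z≢j    = contradiction 1≤0 λ ()
    where
    1≤0 : 1 ℕ.≤ 0
    1≤0 = ℕₚ.≤-trans (ℕₚ.≤-reflexive (≡.trans (≡.sym (∈⇒indicator≡1 z∈I)) (≡.trans (cong (λ β → lookup β z) eq)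
            (≡.trans (lookup-inc-≢ (inc j γ) z≢y) (lookup-inc-≢ γ z≢j)))))
          (ℕₚ.≤-trans (lookup≤inc z x γ) (ℕₚ.≤-reflexive z∉))

-- Positive semidefiniteness of the 0-1 matrix of a partial equivalence relation.

module ParallelClasses {c ℓ} (ℝ : CompleteOrderedField c ℓ) where
  open OrderedField ℝ
  open LinearAlgebra ℝ
  open SetoidReasoning setoid

  𝟙 : ∀ {p} {P : Set p} → Dec P → Carrier
  𝟙 P? = if does P? then 1# else 0#

  𝟙-nonneg : ∀ {p} {P : Set p} (P? : Dec P) → 0# ≤ 𝟙 P?
  𝟙-nonneg (yes _) = inj₁ 0<1
  𝟙-nonneg (no  _) = ≤-refl

  𝟙-true : ∀ {p} {P : Set p} (P? : Dec P) → P → 𝟙 P? ≈ 1#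
  𝟙-true (yes _)  p = refl
  𝟙-true (no  ¬p) p = contradiction p ¬p

  𝟙-false : ∀ {p} {P : Set p} (P? : Dec P) → ¬ P → 𝟙 P? ≈ 0#
  𝟙-false (yes p) ¬p = contradiction p ¬p
  𝟙-false (no  _) ¬p = refl

  𝟙-cong : ∀ {p q} {P : Set p} {Q : Set q} (P? : Dec P) (Q? : Dec Q) → (P → Q) → (Q → P) → 𝟙 P? ≈ 𝟙 Q?
  𝟙-cong (yes p) Q? P⇒Q Q⇒P = sym (𝟙-true Q? (P⇒Q p))
  𝟙-cong (no ¬p) Q? P⇒Q Q⇒P = sym (𝟙-false Q? (λ q → ¬p (Q⇒P q)))

  module _ {n p} {_∥_ : Fin n → Fin n → Set p} (_∥?_ : ∀ i j → Dec (i ∥ j))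
           (∥-sym : ∀ {i j} → i ∥ j → j ∥ i) (∥-trans : ∀ {i j k} → i ∥ j → j ∥ k → i ∥ k) where

    open SymmetricForm (λ i j → 𝟙 (i ∥? j)) (λ i j → 𝟙-cong (i ∥? j) (j ∥? i) ∥-sym ∥-sym)

    -- The form is Σ_C (Σ_{i∈C} vᵢ)² over the classes C; each class is averaged over its elements.
    classes-form-nonneg : ∀ v → 0# ≤ form v v
    classes-form-nonneg v = ≤-respʳ-≈ (sym averaged)
      (sum-nonneg λ k → *-nonneg (⁺⁻¹-nonneg (size k)) (0≤² (row v k)))
      where
      G : Fin n → Fin n → Carrier
      G i j = 𝟙 (i ∥? j)
      size : Fin n → Carrier
      size i = sum (G i)
      row-∥ : ∀ {i j} → i ∥ j → ∀ k → G i k ≈ G j k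
      row-∥ {i} {j} i∥j k = 𝟙-cong (i ∥? k) (j ∥? k) (∥-trans (∥-sym i∥j)) (∥-trans i∥j)
      -- `size` and `row v` depend only on the class, so `k` may be replaced by the parallel element
      -- `i`.
      entry : ∀ i k → size k ⁺⁻¹ * (G k i * v i * row v k) ≈ v i * (size i ⁺⁻¹ * row v i) * G i k
      entry i k with i ∥? k | k ∥? i
      ... | yes i∥k | no ¬k∥i = contradiction (∥-sym i∥k) ¬k∥i
      ... | no ¬i∥k | yes k∥i = contradiction (∥-sym k∥i) ¬i∥k
      ... | no _    | no _    = solve 5 (λ m v r m′ r′ → m :* (:0 :* v :* r) := v :* (m′ :* r′) :* :0)
                                  refl (size k ⁺⁻¹) (v i) (row v k) (size i ⁺⁻¹) (row v i)
      ... | yes i∥k | yes _   = begin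
        size k ⁺⁻¹ * (1# * v i * row v k)     ≈⟨ *-cong (⁺⁻¹-cong (sum-cong (row-∥ k∥i)))
                                                   (*-congˡ (sum-cong λ j → *-congʳ (row-∥ k∥i j))) ⟩
        size i ⁺⁻¹ * (1# * v i * row v i)     ≈⟨ solve 3 (λ m v r → m :* (:1 :* v :* r) := v :* (m :* r) :* :1)
                                                   refl (size i ⁺⁻¹) (v i) (row v i) ⟩
        v i * (size i ⁺⁻¹ * row v i) * 1#     ∎
        where k∥i = ∥-sym i∥k
      normalised : ∀ i → v i * (size i ⁺⁻¹ * row v i) * size i ≈ v i * row v i
      normalised i with sum-nonneg {f = G i} (λ k → 𝟙-nonneg (i ∥? k))
      ... | inj₁ 0<s = begin
        v i * (size i ⁺⁻¹ * row v i) * size i     ≈⟨ solve 4 (λ v m r s → v :* (m :* r) :* s := v :* (s :* m :* r)) refl (v i) (size i ⁺⁻¹) (row v i) (size i) ⟩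
        v i * (size i * size i ⁺⁻¹ * row v i)     ≈⟨ *-congˡ (trans (*-congʳ (*-⁺⁻¹ 0<s)) (*-identityˡ _)) ⟩
        v i * row v i                             ∎
      -- An element outside every class, as a loop will be: its row of `G` is zero, and so are both
      -- sides.
      ... | inj₂ 0≈s = begin
        v i * (size i ⁺⁻¹ * row v i) * size i     ≈⟨ *-congˡ 0≈s ⟨
        v i * (size i ⁺⁻¹ * row v i) * 0#         ≈⟨ solve 2 (λ v r → r :* :0 := v :* :0) refl (v i) _ ⟩
        v i * 0#                                  ≈⟨ *-congˡ (sum-zero {n} λ k → trans
                                                       (*-congʳ (sum≈0⇒≈0 (λ k → 𝟙-nonneg (i ∥? k)) (sym 0≈s) k)) (zeroˡ (v k))) ⟨
        v i * row v i                             ∎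
      averaged : form v v ≈ sum (λ k → size k ⁺⁻¹ * (row v k * row v k))
      averaged = sym (begin
        sum (λ k → size k ⁺⁻¹ * (row v k * row v k))
          ≈⟨ (sum-cong λ k → trans (*-congˡ (*-distribʳ-sum (row v k) (λ i → G k i * v i)))
                                   (*-distribˡ-sum (size k ⁺⁻¹) (λ i → G k i * v i * row v k))) ⟩
        sum (λ k → sum (λ i → size k ⁺⁻¹ * (G k i * v i * row v k)))
          ≈⟨ (sum-cong λ k → sum-cong λ i → entry i k) ⟩
        sum (λ k → sum (λ i → v i * (size i ⁺⁻¹ * row v i) * G i k))
          ≈⟨ ∑-comm (λ k i → v i * (size i ⁺⁻¹ * row v i) * G i k) ⟩
        sum (λ i → sum (λ k → v i * (size i ⁺⁻¹ * row v i) * G i k))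
          ≈⟨ (sum-cong λ i → trans (sym (*-distribˡ-sum (v i * (size i ⁺⁻¹ * row v i)) (G i))) (normalised i)) ⟩
        form v v ∎)

-- Values at 0 of the mixed derivatives of the basis generating polynomial.

module MixedDerivatives {c ℓ} (ℝ : CompleteOrderedField c ℓ) {n} (M : Matroid n)
                        (a : Vector (CompleteOrderedField.Carrier ℝ) n) where
  open OrderedField ℝ
  open LinearAlgebra ℝ
  open ParallelClasses ℝ
  open MatroidProperties M
  open SetoidReasoning setoid

  -- Φ k α is the value at 0 of ∂^α l_a^k f_M.
  Φ : ℕ → Exponent n → Carrier
  Φ zero    α = 𝟙 (isBasis? α)
  Φ (suc k) α = sum (λ i → a i * Φ k (inc i α))

  -- The value at 0 of ∂^α l_v l_a^k f_M.
  D : ℕ → Exponent n → Vector Carrier n → Carrier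
  D k α v = sum (λ i → v i * Φ k (inc i α))

  -- The Hessian at 0 of ∂^α l_a^k f_M; this polynomial is a quadratic form when the sum of `α`, `k`
  -- and 2 add up to the rank.
  Hessian : ℕ → Exponent n → Fin n → Fin n → Carrier
  Hessian k α i j = Φ k (inc i (inc j α))

  Hessian-sym : ∀ k α i j → Hessian k α i j ≈ Hessian k α j i
  Hessian-sym k α i j = reflexive (cong (Φ k) (inc-comm i j α))

  module H k α = SymmetricForm (Hessian k α) (Hessian-sym k α)

  Φ-dependent : ∀ k α → ¬ Independent α → Φ k α ≈ 0#
  Φ-dependent zero    α ¬ind = 𝟙-false (isBasis? α) (λ (ind , _) → ¬ind ind)
  Φ-dependent (suc k) α ¬ind = sum-zero {n} λ i →
    trans (*-congˡ (Φ-dependent k (inc i α) (λ ind → ¬ind (independent-hereditary ind)))) (zeroʳ (a i))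

  D-dependent : ∀ k α v → ¬ Independent α → D k α v ≈ 0#
  D-dependent k α v ¬ind = sum-zero {n} λ i →
    trans (*-congˡ (Φ-dependent k (inc i α) (λ ind → ¬ind (independent-hereditary ind)))) (zeroʳ (v i))

  form-dependent : ∀ k α u v → ¬ Independent α → H.form k α u v ≈ 0#
  form-dependent k α u v ¬ind = sum-zero {n} λ i → trans
    (*-congˡ (sum-zero {n} λ j → trans
      (*-congʳ (Φ-dependent k _ (λ ind → ¬ind (independent-hereditary (independent-hereditary ind)))))
      (zeroˡ (v j))))
    (zeroʳ (u i))

  row≈D : ∀ k α v i → H.row k α v i ≈ D k (inc i α) v
  row≈D k α v i = sum-cong λ j → trans (*-comm _ (v j)) (*-congˡ (reflexive (cong (Φ k) (inc-comm i j α))))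

  -- The factor l_a joins the power of l_a. With `row≈D`, the entry of H a at `i` in level `suc k`
  -- is thus the value at `a` of the form of the contraction by `i` in level `k`: the denominators
  -- of D are those of the Cauchy-Schwarz inequalities one degree lower.
  form-a : ∀ k α v → H.form k α a v ≈ D (suc k) α v
  form-a k α v = begin
    H.form k α a v                                             ≈⟨ H.form-comm k α a v ⟩
    sum (λ i → v i * H.row k α a i)                            ≈⟨ (sum-cong λ i → *-congˡ (row≈D k α a i)) ⟩
    D (suc k) α v                                              ∎

  row-suc : ∀ k α v i → H.row (suc k) α v i ≈ sum (λ l → a l * H.row k (inc l α) v i)
  row-suc k α v i = begin
    sum (λ j → Φ (suc k) (inc i (inc j α)) * v j)
      ≈⟨ (sum-cong λ j → *-distribʳ-sum (v j) (λ l → a l * Φ k (inc l (inc i (inc j α))))) ⟩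
    sum (λ j → sum (λ l → a l * Φ k (inc l (inc i (inc j α))) * v j))
      ≈⟨ ∑-comm (λ j l → a l * Φ k (inc l (inc i (inc j α))) * v j) ⟩
    sum (λ l → sum (λ j → a l * Φ k (inc l (inc i (inc j α))) * v j))
      ≈⟨ (sum-cong λ l → sum-cong λ j → trans (*-assoc (a l) _ (v j))
           (*-congˡ (*-congʳ (reflexive (cong (Φ k) (inc-rotate i j l α)))))) ⟩
    sum (λ l → sum (λ j → a l * (Hessian k (inc l α) i j * v j)))
      ≈⟨ (sum-cong λ l → *-distribˡ-sum (a l) (λ j → Hessian k (inc l α) i j * v j)) ⟨
    sum (λ l → a l * H.row k (inc l α) v i) ∎

  form-suc : ∀ k α u v → H.form (suc k) α u v ≈ sum (λ l → a l * H.form k (inc l α) u v)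
  form-suc k α u v = begin
    sum (λ i → u i * H.row (suc k) α v i)
      ≈⟨ (sum-cong λ i → trans (*-congˡ (row-suc k α v i)) (*-distribˡ-sum (u i) (λ l → a l * H.row k (inc l α) v i))) ⟩
    sum (λ i → sum (λ l → u i * (a l * H.row k (inc l α) v i)))
      ≈⟨ ∑-comm (λ i l → u i * (a l * H.row k (inc l α) v i)) ⟩
    sum (λ l → sum (λ i → u i * (a l * H.row k (inc l α) v i)))
      ≈⟨ (sum-cong λ l → trans
           (sum-cong λ i → solve 3 (λ u a r → u :* (a :* r) := a :* (u :* r)) refl (u i) (a l) (H.row k (inc l α) v i))
           (sym (*-distribˡ-sum (a l) (λ i → u i * H.row k (inc l α) v i)))) ⟩
    sum (λ l → a l * H.form k (inc l α) u v) ∎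

  -- All mixed partial derivatives of l_v f_M of order k, starting from ∂^α, vanish at 0.
  Null : ℕ → Exponent n → Vector Carrier n → Set _
  Null zero    α v = D 0 α v ≈ 0#
  Null (suc k) α v = ∀ i → Null k (inc i α) v

  Null-dependent : ∀ k α v → ¬ Independent α → Null k α v
  Null-dependent zero    α v ¬ind   = D-dependent 0 α v ¬ind
  Null-dependent (suc k) α v ¬ind i = Null-dependent k (inc i α) v λ ind → ¬ind (independent-hereditary ind)

-- Negativity on the complement of a and the isotropic vectors, for e not a coloop.

module Positivity {c ℓ} (ℝ : CompleteOrderedField c ℓ) {n} (M : Matroid n)
                  (a : Vector (CompleteOrderedField.Carrier ℝ) n) (e : Fin n)
                  (a-relint : relintH ℝ e a) (¬coloop : ¬ Coloop M e) where
  open OrderedField ℝ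
  open LinearAlgebra ℝ
  open ParallelClasses ℝ
  open MatroidProperties M
  open MixedDerivatives ℝ M a
  open SetoidReasoning setoid

  private
    d = rank M

    0≤a : ∀ i → 0# ≤ a i
    0≤a i with i Finₚ.≟ e
    ... | yes ≡.refl = inj₂ (sym (proj₁ a-relint))
    ... | no  i≢e    = inj₁ (proj₂ a-relint i i≢e)

  basis-avoiding-e : ∃ λ B → Basis M B × e ∉ B
  basis-avoiding-e = decidable-stable (Subsetₚ.anySubset? λ B → Basis? M B ×-dec ¬? (e Subsetₚ.∈? B))
    λ ∄ → ¬coloop λ B basis → decidable-stable (e Subsetₚ.∈? B) λ e∉B → ∄ (B , basis , e∉B)

  -- Augmenting from a basis without `e` yields an element of positive weight, even when `γ`
  -- contains `e`. Positivity of `Φ` and connectedness both rest on this.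
  extend : ∀ {γ} → Independent γ → Vec.sum γ ℕ.< d → ∃ λ x → 0# < a x × Independent (inc x γ)
  extend {γ} ind Σ<d with basis-avoiding-e
  ... | B , basis , e∉B with augment (proj₁ basis) ind (≡.subst (Vec.sum γ ℕ.<_) (≡.sym (basis⇒∣∣≡rank basis)) Σ<d)
  ...   | x , x∈B , _ , indx = x , proj₂ a-relint x (λ x≡e → e∉B (≡.subst (_∈ B) x≡e x∈B)) , indx

  Φ-nonneg : ∀ k α → 0# ≤ Φ k α
  Φ-nonneg zero    α = 𝟙-nonneg (isBasis? α)
  Φ-nonneg (suc k) α = sum-nonneg λ i → *-nonneg (0≤a i) (Φ-nonneg k (inc i α))

  sum-inc-k : ∀ {k} (i : Fin n) (α : Exponent n) → Vec.sum α ℕ.+ suc k ≡ d → Vec.sum (inc i α) ℕ.+ k ≡ d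
  sum-inc-k {k} i α eq = ≡.trans (cong (ℕ._+ k) (sum-inc i α)) (≡.trans (≡.sym (ℕₚ.+-suc _ k)) eq)

  sum<d : ∀ {k} (α : Exponent n) → Vec.sum α ℕ.+ suc k ≡ d → Vec.sum α ℕ.< d
  sum<d {k} α eq = ≡.subst (Vec.sum α ℕ.<_) eq (ℕₚ.m<m+n (Vec.sum α) (ℕ.s≤s ℕ.z≤n))

  Φ-pos : ∀ k {α : Exponent n} → Independent α → Vec.sum α ℕ.+ k ≡ d → 0# < Φ k α
  Φ-pos zero    {α} ind eq = <-respʳ-≈ (sym (𝟙-true (isBasis? α) (ind , ≡.trans (≡.sym (ℕₚ.+-identityʳ _)) eq))) 0<1
  Φ-pos (suc k) {α} ind eq with extend ind (sum<d α eq)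
  ... | x , 0<ax , indx = sum-pos {f = λ i → a i * Φ k (inc i α)} (λ i → *-nonneg (0≤a i) (Φ-nonneg k (inc i α))) x
                            (*-pos 0<ax (Φ-pos k indx (sum-inc-k x α eq)))

  form-aa-pos : ∀ k {α : Exponent n} → Independent α → Vec.sum α ℕ.+ suc (suc k) ≡ d → 0# < H.form k α a a
  form-aa-pos k {α} ind eq = <-respʳ-≈ (sym (form-a k α a)) (Φ-pos (suc (suc k)) ind eq)

  -- The contraction has rank two, so two nonloops fail to be jointly independent exactly when they
  -- are parallel. The Hessian is therefore the rank-one matrix of `N` minus the positive
  -- semidefinite matrix `G` of the parallel classes.
  negative-degree-2 : ∀ α → Independent α → Vec.sum α ℕ.+ 2 ≡ d → H.NegativeOnComplement 0 α a
  negative-degree-2 α ind eq v av≈0 = 0≤-⇒≤ (≤-respʳ-≈ vv≈ (*-cancel-0≤ 0<T² main))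
    where
    nonloop? : ∀ i → Dec (Independent (inc i α))
    nonloop? i = Independent? (inc i α)
    N : Vector Carrier n
    N i = 𝟙 (nonloop? i)
    Parallel : Fin n → Fin n → Set
    Parallel i j = Independent (inc i α) × Independent (inc j α) × ¬ Independent (inc i (inc j α))
    parallel? : ∀ i j → Dec (Parallel i j)
    parallel? i j = nonloop? i ×-dec nonloop? j ×-dec ¬? (Independent? (inc i (inc j α)))
    parallel-sym : ∀ {i j} → Parallel i j → Parallel j i
    parallel-sym {i} {j} (indi , indj , ¬indij) =
      indj , indi , λ indji → ¬indij (≡.subst Independent (inc-comm j i α) indji)
    parallel-trans : ∀ {i j k} → Parallel i j → Parallel j k → Parallel i k
    parallel-trans {i} {j} {k} (indi , indj , ¬indij) (_ , indk , ¬indjk) = indi , indk , λ indik →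
      case independent-exchange indj indik of λ where
        (inj₁ indij) → ¬indij indij
        (inj₂ indkj) → ¬indjk (≡.subst Independent (inc-comm k j α) indkj)
    G : Fin n → Fin n → Carrier
    G i j = 𝟙 (parallel? i j)
    module G = SymmetricForm G (λ i j → 𝟙-cong (parallel? i j) (parallel? j i) parallel-sym parallel-sym)
    entry : ∀ i j → Hessian 0 α i j ≈ N i * N j - G i j
    entry i j = by-cases (Independent? (inc i (inc j α))) (nonloop? i) (nonloop? j)
      where
      by-cases : Dec (Independent (inc i (inc j α))) → Dec (Independent (inc i α)) → Dec (Independent (inc j α)) →
                 Hessian 0 α i j ≈ N i * N j - G i j
      by-cases (yes indij) _ _ = begin
        Hessian 0 α i j    ≈⟨ 𝟙-true (isBasis? _) (indij , ≡.trans (sum-inc i (inc j α))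
                                (≡.trans (cong suc (sum-inc j α)) (≡.trans (ℕₚ.+-comm 2 _) eq))) ⟩
        1#                 ≈⟨ solve 0 (:1 := :1 :* :1 :- :0) refl ⟩
        1# * 1# - 0#       ≈⟨ +-cong (*-cong (𝟙-true (nonloop? i) (independent-hereditary (≡.subst Independent (inc-comm i j α) indij)))
                                             (𝟙-true (nonloop? j) (independent-hereditary indij)))
                                     (-‿cong (𝟙-false (parallel? i j) (λ (_ , _ , ¬indij) → ¬indij indij))) ⟨
        N i * N j - G i j  ∎
      by-cases (no ¬indij) (yes indi) (yes indj) = begin
        Hessian 0 α i j    ≈⟨ Φ-dependent 0 _ ¬indij ⟩
        0#                 ≈⟨ solve 0 (:0 := :1 :* :1 :- :1) refl ⟩
        1# * 1# - 1#       ≈⟨ +-cong (*-cong (𝟙-true (nonloop? i) indi) (𝟙-true (nonloop? j) indj))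
                                     (-‿cong (𝟙-true (parallel? i j) (indi , indj , ¬indij))) ⟨
        N i * N j - G i j  ∎
      by-cases (no ¬indij) (no ¬indi) _ = begin
        Hessian 0 α i j    ≈⟨ Φ-dependent 0 _ ¬indij ⟩
        0#                 ≈⟨ solve 1 (λ x → :0 := :0 :* x :- :0) refl (N j) ⟩
        0# * N j - 0#      ≈⟨ +-cong (*-congʳ (𝟙-false (nonloop? i) ¬indi))
                                     (-‿cong (𝟙-false (parallel? i j) (λ (indi , _) → ¬indi indi))) ⟨
        N i * N j - G i j  ∎
      by-cases (no ¬indij) _ (no ¬indj) = begin
        Hessian 0 α i j    ≈⟨ Φ-dependent 0 _ ¬indij ⟩
        0#                 ≈⟨ solve 1 (λ x → :0 := x :* :0 :- :0) refl (N i) ⟩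
        N i * 0# - 0#      ≈⟨ +-cong (*-congˡ (𝟙-false (nonloop? j) ¬indj))
                                     (-‿cong (𝟙-false (parallel? i j) (λ (_ , indj , _) → ¬indj indj))) ⟨
        N i * N j - G i j  ∎
    form≈ : ∀ u w → H.form 0 α u w ≈ (N ∙ u) * (N ∙ w) - G.form u w
    form≈ u w = begin
      sum (λ i → u i * sum (λ j → Hessian 0 α i j * w j))
        ≈⟨ (sum-cong λ i → *-congˡ (sum-cong λ j → trans (*-congʳ (entry i j))
             (solve 4 (λ n m g w → (n :* m :- g) :* w := n :* (m :* w) :- g :* w) refl (N i) (N j) (G i j) (w j)))) ⟩
      sum (λ i → u i * sum (λ j → N i * (N j * w j) - G i j * w j))
        ≈⟨ (sum-cong λ i → *-congˡ (trans (sum-sub {n} _ _) (+-congʳ (sym (*-distribˡ-sum (N i) (λ j → N j * w j)))))) ⟩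
      sum (λ i → u i * (N i * (N ∙ w) - G.row w i))
        ≈⟨ (sum-cong λ i → solve 4 (λ u n s g → u :* (n :* s :- g) := n :* u :* s :- u :* g) refl (u i) (N i) (N ∙ w) (G.row w i)) ⟩
      sum (λ i → N i * u i * (N ∙ w) - u i * G.row w i)
        ≈⟨ sum-sub {n} _ _ ⟩
      sum (λ i → N i * u i * (N ∙ w)) - G.form u w
        ≈⟨ +-congʳ (sym (*-distribʳ-sum (N ∙ w) (λ i → N i * u i))) ⟩
      (N ∙ u) * (N ∙ w) - G.form u w ∎
    T = N ∙ a
    S = N ∙ v
    0≤G : ∀ w → 0# ≤ G.form w w
    0≤G = classes-form-nonneg parallel? parallel-sym parallel-trans
    0<aa : 0# < H.form 0 α a a
    0<aa = form-aa-pos 0 ind eq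
    Gva≈TS : G.form v a ≈ T * S
    Gva≈TS = begin
      G.form v a                            ≈⟨ G.form-comm v a ⟩
      G.form a v                            ≈⟨ solve 2 (λ t g → g := t :- (t :- g)) refl (T * S) (G.form a v) ⟩
      T * S - (T * S - G.form a v)          ≈⟨ +-congˡ (-‿cong (trans (sym (form≈ a v)) av≈0)) ⟩
      T * S - 0#                            ≈⟨ solve 1 (λ t → t :- :0 := t) refl (T * S) ⟩
      T * S                                 ∎
    vv≈ : G.form v v - S * S ≈ 0# - H.form 0 α v v
    vv≈ = trans (solve 2 (λ g s → g :- s :* s := :0 :- (s :* s :- g)) refl (G.form v v) S)
                (+-congˡ (-‿cong (sym (form≈ v v))))
    0<T² : 0# < T * T
    0<T² = <-respʳ-≈ (trans (+-congʳ (form≈ a a)) (solve 2 (λ t g → (t :* t :- g) :+ g := t :* t) refl T (G.form a a)))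
      (+-pos-nonneg 0<aa (0≤G a))
    -- `N ∙ z` is zero, so the form takes the value `- G.form z z` at `z`; since `a` and `v` are
    -- orthogonal, that value is also T² H(v, v) + S² H(a, a).
    z = comb T v (- S) a
    main : 0# ≤ T * T * (G.form v v - S * S)
    main = ≤-respʳ-≈ (begin
      G.form z z + S * S * H.form 0 α a a
        ≈⟨ +-cong (G.form-comb² T v (- S) a) (*-congˡ (form≈ a a)) ⟩
      T * T * G.form v v + (T * - S * G.form v a + T * - S * G.form v a) + - S * - S * G.form a a + S * S * (T * T - G.form a a)
        ≈⟨ +-congʳ (+-congʳ (+-congˡ (+-cong (*-congˡ Gva≈TS) (*-congˡ Gva≈TS)))) ⟩
      T * T * G.form v v + (T * - S * (T * S) + T * - S * (T * S)) + - S * - S * G.form a a + S * S * (T * T - G.form a a)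
        ≈⟨ solve 4 (λ t s gvv gaa → t :* t :* gvv :+ (t :* :- s :* (t :* s) :+ t :* :- s :* (t :* s)) :+ :- s :* :- s :* gaa :+ s :* s :* (t :* t :- gaa)
             := t :* t :* (gvv :- s :* s)) refl T S (G.form v v) (G.form a a) ⟩
      T * T * (G.form v v - S * S) ∎)
      (+-nonneg (0≤G z) (*-nonneg (0≤² S) (inj₁ 0<aa)))

  -- Mutual induction with `row-bound`, which uses this statement one level lower at each
  -- independent `inc i α`.
  negative : ∀ k α → Independent α → Vec.sum α ℕ.+ suc (suc k) ≡ d → H.NegativeOnComplement k α a

  -- Cauchy–Schwarz for each ∂_i f_M, summed with weights a_i.
  row-bound : ∀ k α → Vec.sum α ℕ.+ suc (suc (suc k)) ≡ d → ∀ v →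
    H.form (suc k) α v v ≤
    sum (λ i → a i * (H.row (suc k) α a i ⁺⁻¹ * (H.row (suc k) α v i * H.row (suc k) α v i)))

  negative zero    α ind eq = negative-degree-2 α ind eq
  negative (suc k) α ind eq = H.negative-on-complement (suc k) α
    (λ i j → Φ-nonneg (suc k) (inc i (inc j α))) 0≤a (row-bound k α eq) constant
    where
    constant : ∀ r → (∀ i j → Hessian (suc k) α i j * (a i * a j) * ((r i - r j) * (r i - r j)) ≈ 0#) →
               ∃ λ c → ∀ i j → Hessian (suc k) α i j * (a j * r j) ≈ c * (Hessian (suc k) α i j * a j)
    constant r flat with extend ind (sum<d α eq)
    ... | x , 0<ax , indx = r x , λ i j → by-cases i j (0≤a j) (Independent? (inc j α))
      where
      adjacent : ∀ {i j} → 0# < a i → 0# < a j → Independent (inc i (inc j α)) → r i ≈ r j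
      adjacent {i} {j} 0<ai 0<aj indij = begin
        r i                     ≈⟨ solve 2 (λ x y → x := x :- y :+ y) refl (r i) (r j) ⟩
        r i - r j + r j         ≈⟨ +-congʳ (²≈0⇒≈0 (*-cancel-≈0 (*-pos 0<H (*-pos 0<ai 0<aj)) (flat i j))) ⟩
        0# + r j                ≈⟨ +-identityˡ (r j) ⟩
        r j                     ∎
        where
        0<H : 0# < Hessian (suc k) α i j
        0<H = Φ-pos (suc k) indij (sum-inc-k i (inc j α) (sum-inc-k j α eq))
      -- A path of length at most two leads from `j` to the fixed vertex `x`: extend `j` by an
      -- element `y` of positive weight, and exchange makes `x` adjacent to `y` or to `j`. The
      -- degree is at least three here, so adjacent pairs have a positive Hessian entry.
      connected : ∀ {j} → 0# < a j → Independent (inc j α) → r j ≈ r x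
      connected {j} 0<aj indj with extend indj (sum<d (inc j α) (sum-inc-k j α eq))
      ... | y , 0<ay , indyj with independent-exchange indx indyj
      ...   | inj₁ indyx = trans (sym (adjacent 0<ay 0<aj indyj)) (adjacent 0<ay 0<ax indyx)
      ...   | inj₂ indjx = adjacent 0<aj 0<ax indjx
      by-cases : ∀ i j → 0# ≤ a j → Dec (Independent (inc j α)) →
                 Hessian (suc k) α i j * (a j * r j) ≈ r x * (Hessian (suc k) α i j * a j)
      by-cases i j (inj₁ 0<aj) (yes indj) = trans
        (solve 3 (λ h a r → h :* (a :* r) := r :* (h :* a)) refl (Hessian (suc k) α i j) (a j) (r j))
        (*-congʳ (connected 0<aj indj))
      by-cases i j (inj₂ 0≈aj) _ = begin
        Hessian (suc k) α i j * (a j * r j)      ≈⟨ *-congˡ (*-congʳ 0≈aj) ⟨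
        Hessian (suc k) α i j * (0# * r j)       ≈⟨ solve 3 (λ h r c → h :* (:0 :* r) := c :* (h :* :0)) refl _ (r j) (r x) ⟩
        r x * (Hessian (suc k) α i j * 0#)       ≈⟨ *-congˡ (*-congˡ 0≈aj) ⟩
        r x * (Hessian (suc k) α i j * a j)      ∎
      by-cases i j (inj₁ _) (no ¬indj) = begin
        Hessian (suc k) α i j * (a j * r j)      ≈⟨ *-congʳ H≈0 ⟩
        0# * (a j * r j)                         ≈⟨ solve 3 (λ a r c → :0 :* (a :* r) := c :* (:0 :* a)) refl (a j) (r j) (r x) ⟩
        r x * (0# * a j)                         ≈⟨ *-congˡ (*-congʳ H≈0) ⟨
        r x * (Hessian (suc k) α i j * a j)      ∎
        where
        H≈0 : Hessian (suc k) α i j ≈ 0#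
        H≈0 = Φ-dependent (suc k) _ (λ ind → ¬indj (independent-hereditary ind))

  row-bound k α eq v = ≤-respˡ-≈ (sym (form-suc k α v v)) (sum-mono-≤ λ i → *-monoˡ-≤ (0≤a i) (bound i (Independent? (inc i α))))
    where
    s t : Vector Carrier n
    s = H.row (suc k) α a
    t = H.row (suc k) α v
    bound : ∀ i → Dec (Independent (inc i α)) → H.form k (inc i α) v v ≤ s i ⁺⁻¹ * (t i * t i)
    -- The contraction by a loop has zero form, and the right-hand side is nonnegative even at the
    -- junk value of the inverse.
    bound i (no ¬indi) = ≤-respˡ-≈ (sym (form-dependent k (inc i α) v v ¬indi)) (*-nonneg (⁺⁻¹-nonneg (s i)) (0≤² (t i)))
    bound i (yes indi) = ≤-respˡ-≈ cancel (*-monoˡ-≤ (⁺⁻¹-nonneg (s i)) cauchy-schwarz)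
      where
      eq′ : Vec.sum (inc i α) ℕ.+ suc (suc k) ≡ d
      eq′ = sum-inc-k i α eq
      aa≈s : H.form k (inc i α) a a ≈ s i
      aa≈s = trans (form-a k (inc i α) a) (sym (row≈D (suc k) α a i))
      av≈t : H.form k (inc i α) a v ≈ t i
      av≈t = trans (form-a k (inc i α) v) (sym (row≈D (suc k) α v i))
      0<aa : 0# < H.form k (inc i α) a a
      0<aa = form-aa-pos k indi eq′
      cauchy-schwarz : s i * H.form k (inc i α) v v ≤ t i * t i
      cauchy-schwarz = ≤-respˡ-≈ (*-congʳ aa≈s) (≤-respʳ-≈ (*-cong av≈t av≈t)
        (H.reverse-cauchy-schwarz k (inc i α) 0<aa (negative k (inc i α) indi eq′) v))
      cancel : s i ⁺⁻¹ * (s i * H.form k (inc i α) v v) ≈ H.form k (inc i α) v v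
      cancel = begin
        s i ⁺⁻¹ * (s i * H.form k (inc i α) v v)    ≈⟨ solve 3 (λ p s q → p :* (s :* q) := s :* p :* q) refl (s i ⁺⁻¹) (s i) _ ⟩
        s i * s i ⁺⁻¹ * H.form k (inc i α) v v      ≈⟨ *-congʳ (*-⁺⁻¹ (<-respʳ-≈ aa≈s 0<aa)) ⟩
        1# * H.form k (inc i α) v v                 ≈⟨ *-identityˡ _ ⟩
        H.form k (inc i α) v v                      ∎

  -- Descent in the degree. The row of `v` vanishes, so `v` is orthogonal to `a` in every
  -- contraction and its values there are at most zero. Weighted by `a` they add up to zero, so `v`
  -- is isotropic in each contraction of positive weight.
  isotropic⇒Null : ∀ k α v → Vec.sum α ℕ.+ suc (suc k) ≡ d →
                   H.form k α a v ≈ 0# → H.form k α v v ≈ 0# → Null (suc k) α v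
  isotropic⇒Null k α v eq av≈0 vv≈0 with Independent? α
  ... | no ¬ind = Null-dependent (suc k) α v ¬ind
  isotropic⇒Null zero α v eq av≈0 vv≈0 | yes ind = λ i → trans (sym (row≈D 0 α v i))
    (H.isotropic⇒null 0 α (form-aa-pos 0 ind eq) (negative 0 α ind eq) av≈0 vv≈0 i)
  isotropic⇒Null (suc k) α v eq av≈0 vv≈0 | yes ind = λ i → null i (i Finₚ.≟ e)
    where
    row≈0 : ∀ i → H.row (suc k) α v i ≈ 0#
    row≈0 = H.isotropic⇒null (suc k) α (form-aa-pos (suc k) ind eq) (negative (suc k) α ind eq) av≈0 vv≈0
    avᵢ≈0 : ∀ i → H.form k (inc i α) a v ≈ 0#
    avᵢ≈0 i = trans (form-a k (inc i α) v) (trans (sym (row≈D (suc k) α v i)) (row≈0 i))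
    vvᵢ≤0 : ∀ i → H.form k (inc i α) v v ≤ 0#
    vvᵢ≤0 i with Independent? (inc i α)
    ... | yes indi = negative k (inc i α) indi (sum-inc-k i α eq) v (avᵢ≈0 i)
    ... | no ¬indi = inj₂ (form-dependent k (inc i α) v v ¬indi)
    a*-vvᵢ≈0 : ∀ i → a i * - H.form k (inc i α) v v ≈ 0#
    a*-vvᵢ≈0 = sum≈0⇒≈0 (λ i → *-nonneg (0≤a i) (-‿nonpos (vvᵢ≤0 i))) (begin
      sum (λ i → a i * - H.form k (inc i α) v v)       ≈⟨ (sum-cong λ i → solve 2 (λ a q → a :* :- q := :- :1 :* (a :* q)) refl (a i) (H.form k (inc i α) v v)) ⟩
      sum (λ i → - 1# * (a i * H.form k (inc i α) v v)) ≈⟨ *-distribˡ-sum (- 1#) (λ i → a i * H.form k (inc i α) v v) ⟨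
      - 1# * sum (λ i → a i * H.form k (inc i α) v v)  ≈⟨ *-congˡ (trans (sym (form-suc k α v v)) vv≈0) ⟩
      - 1# * 0#                                        ≈⟨ zeroʳ (- 1#) ⟩
      0#                                               ∎)
    null-≢e : ∀ {i} → i ≢ e → Null (suc k) (inc i α) v
    null-≢e {i} i≢e = isotropic⇒Null k (inc i α) v (sum-inc-k i α eq) (avᵢ≈0 i) (begin
      q            ≈⟨ solve 1 (λ q → q := :- (:- q)) refl q ⟩
      - (- q)      ≈⟨ -‿cong (*-cancel-≈0 (proj₂ a-relint i i≢e) (a*-vvᵢ≈0 i)) ⟩
      - 0#         ≈⟨ solve 0 (:- :0 := :0) refl ⟩
      0#           ∎)
      where q = H.form k (inc i α) v v
    null : ∀ i → Dec (i ≡ e) → Null (suc k) (inc i α) v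
    null i (no  i≢e)    = null-≢e i≢e
    -- The coefficient of ∂_e in l_a vanishes, but ∂_e² f_M = 0 and ∂_j ∂_e = ∂_e ∂_j for j ≠ e.
    null i (yes ≡.refl) j with j Finₚ.≟ e
    ... | yes ≡.refl = Null-dependent k (inc e (inc e α)) v (¬independent-inc² e α)
    ... | no  j≢e    = ≡.subst (λ β → Null k β v) (inc-comm e j α) (null-≢e j≢e e)

-- The monoid of exponents and the enumeration of subsets.

infixl 6 _⊕_
_⊕_ : Exponent n → Exponent n → Exponent n
_⊕_ = zipWith ℕ._+_

0ᴱ : Exponent n
0ᴱ = replicate _ 0

⊕-comm : ∀ (α β : Exponent n) → α ⊕ β ≡ β ⊕ α
⊕-comm = Vecₚ.zipWith-comm ℕₚ.+-comm

⊕-assoc : ∀ (α β γ : Exponent n) → (α ⊕ β) ⊕ γ ≡ α ⊕ (β ⊕ γ)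
⊕-assoc = Vecₚ.zipWith-assoc ℕₚ.+-assoc

⊕-identityʳ : ∀ (α : Exponent n) → α ⊕ 0ᴱ ≡ α
⊕-identityʳ = Vecₚ.zipWith-identityʳ ℕₚ.+-identityʳ

inc-⊕ : ∀ (i : Fin n) α β → inc i α ⊕ β ≡ inc i (α ⊕ β)
inc-⊕ zero    (k ∷ α) (m ∷ β) = ≡.refl
inc-⊕ (suc i) (k ∷ α) (m ∷ β) = cong (k ℕ.+ m ∷_) (inc-⊕ i α β)

⊕-inc : ∀ (i : Fin n) α β → α ⊕ inc i β ≡ inc i (α ⊕ β)
⊕-inc i α β = ≡.trans (⊕-comm α (inc i β)) (≡.trans (inc-⊕ i β α) (cong (inc i) (⊕-comm β α)))

inc-0ᴱ-⊕ : ∀ (i : Fin n) α → inc i 0ᴱ ⊕ α ≡ inc i α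
inc-0ᴱ-⊕ i α = ≡.trans (inc-⊕ i 0ᴱ α) (cong (inc i) (≡.trans (⊕-comm 0ᴱ α) (⊕-identityʳ α)))

indicator-⊥ : ∀ n → indicator (Subset.⊥ {n}) ≡ 0ᴱ
indicator-⊥ zero    = ≡.refl
indicator-⊥ (suc n) = cong (0 ∷_) (indicator-⊥ n)

indicator-⁅⁆ : ∀ (i : Fin n) → indicator ⁅ i ⁆ ≡ inc i 0ᴱ
indicator-⁅⁆ {suc n} zero    = cong (1 ∷_) (indicator-⊥ n)
indicator-⁅⁆ (suc i) = cong (0 ∷_) (indicator-⁅⁆ i)

sum-0ᴱ : ∀ n → Vec.sum (0ᴱ {n}) ≡ 0
sum-0ᴱ zero    = ≡.refl
sum-0ᴱ (suc n) = sum-0ᴱ n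

sum≡0⇒0ᴱ : ∀ (γ : Exponent n) → Vec.sum γ ≡ 0 → γ ≡ 0ᴱ
sum≡0⇒0ᴱ []         _  = ≡.refl
sum≡0⇒0ᴱ (zero ∷ γ) eq = cong (0 ∷_) (sum≡0⇒0ᴱ γ eq)

lookup≤sum : ∀ (γ : Exponent n) i → lookup γ i ℕ.≤ Vec.sum γ
lookup≤sum (k ∷ γ) zero    = ℕₚ.m≤m+n k _
lookup≤sum (k ∷ γ) (suc i) = ℕₚ.≤-trans (lookup≤sum γ i) (ℕₚ.m≤n+m _ k)

indicator-injective : ∀ {I J : Subset n} → indicator I ≡ indicator J → I ≡ J
indicator-injective {I = []}          {[]}          _  = ≡.refl
indicator-injective {I = inside ∷ _}  {inside ∷ _}  eq = cong (inside ∷_) (indicator-injective (Vecₚ.∷-injectiveʳ eq))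
indicator-injective {I = outside ∷ _} {outside ∷ _} eq = cong (outside ∷_) (indicator-injective (Vecₚ.∷-injectiveʳ eq))

indicator-remove : ∀ {x : Fin n} {I} → x ∈ I → indicator I ≡ inc x (indicator (I Subset.- x))
indicator-remove {I = inside ∷ I} Vec.here = cong (1 ∷_) (cong indicator (≡.sym (Subsetₚ.p─⊥≡p I)))
indicator-remove {I = b ∷ I} (Vec.there x∈I) = cong (_ ∷_) (indicator-remove x∈I)

subsets-unique : ∀ n → Unique (subsets n)
subsets-unique zero    = [] ∷ []
subsets-unique (suc n) = Uniqueₚ.++⁺
  (Uniqueₚ.map⁺ Vecₚ.∷-injectiveʳ (subsets-unique n))
  (Uniqueₚ.map⁺ Vecₚ.∷-injectiveʳ (subsets-unique n))
  λ (v∈in , v∈out) → case (∈-map⁻ (inside ∷_) v∈in , ∈-map⁻ (outside ∷_) v∈out) of λ where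
    ((_ , _ , ≡.refl) , (_ , _ , ()))

-- The exponents visited by the nested folds in the definition of ∂^.
shift : Exponent n → List (Fin n) → Exponent n → Exponent n
shift β []       α = α
shift β (e ∷ es) α = shift β es (updateAt α e (lookup β e ℕ.+_))

shift-suc : ∀ k (β : Exponent n) es m α → shift (k ∷ β) (map suc es) (m ∷ α) ≡ m ∷ shift β es α
shift-suc k β []       m α = ≡.refl
shift-suc k β (e ∷ es) m α = shift-suc k β es m _

shift-allFin : ∀ (β α : Exponent n) → shift β (allFin n) α ≡ β ⊕ α
shift-allFin []      []      = ≡.refl
shift-allFin {suc n} (k ∷ β) (m ∷ α) = ≡.trans
  (cong (λ es → shift (k ∷ β) es (k ℕ.+ m ∷ α)) (≡.sym (Listₚ.map-tabulate (λ i → i) suc)))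
  (≡.trans (shift-suc k β (allFin n) (k ℕ.+ m) α) (cong (k ℕ.+ m ∷_) (shift-allFin β α)))

-- Linear functionals on formal sums, and the action of differential operators.

module Evaluation {c ℓ} (ℝ : CompleteOrderedField c ℓ) (n : ℕ) where
  open OrderedField ℝ
  open ParallelClasses ℝ
  open Polynomials ℝ n
  open Mult semiring using (×-congʳ) renaming (_×_ to _·_)
  open SetoidReasoning setoid

  -- The linear functional taking ∂^β to `g β`. Coefficients, products and the action on `f_M` are
  -- all expressed through such functionals, which avoids normal forms for formal sums.
  eval : (Exponent n → Carrier) → Poly → Carrier
  eval g []            = 0#
  eval g ((b , β) ∷ ξ) = b * g β + eval g ξ

  eval-cong : ∀ {g h} → (∀ β → g β ≈ h β) → ∀ ξ → eval g ξ ≈ eval h ξ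
  eval-cong g≈h []            = refl
  eval-cong g≈h ((b , β) ∷ ξ) = +-cong (*-congˡ (g≈h β)) (eval-cong g≈h ξ)

  eval-++ : ∀ g ξ η → eval g (ξ ++ η) ≈ eval g ξ + eval g η
  eval-++ g []            η = sym (+-identityˡ _)
  eval-++ g ((b , β) ∷ ξ) η = trans (+-congˡ (eval-++ g ξ η)) (sym (+-assoc _ _ _))

  eval-∙ : ∀ g x ξ → eval g (x ∙ₚ ξ) ≈ x * eval g ξ
  eval-∙ g x []            = sym (zeroʳ x)
  eval-∙ g x ((b , β) ∷ ξ) = begin
    x * b * g β + eval g (x ∙ₚ ξ)    ≈⟨ +-cong (*-assoc x b (g β)) (eval-∙ g x ξ) ⟩
    x * (b * g β) + x * eval g ξ     ≈⟨ distribˡ x _ _ ⟨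
    x * (b * g β + eval g ξ)         ∎

  eval-monomial-* : ∀ g x α η → eval g (map (λ (b , β) → x * b , α ⊕ β) η) ≈ x * eval (λ β → g (α ⊕ β)) η
  eval-monomial-* g x α []            = sym (zeroʳ x)
  eval-monomial-* g x α ((b , β) ∷ η) = begin
    x * b * g (α ⊕ β) + eval g (map (λ (b , β) → x * b , α ⊕ β) η)    ≈⟨ +-cong (*-assoc x b _) (eval-monomial-* g x α η) ⟩
    x * (b * g (α ⊕ β)) + x * eval (λ β → g (α ⊕ β)) η               ≈⟨ distribˡ x _ _ ⟨
    x * (b * g (α ⊕ β) + eval (λ β → g (α ⊕ β)) η)                   ∎

  eval-* : ∀ g ξ η → eval g (ξ *ₚ η) ≈ eval (λ β → eval (λ γ → g (β ⊕ γ)) η) ξ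
  eval-* g []            η = refl
  eval-* g ((b , β) ∷ ξ) η = trans (eval-++ g (map _ η) (ξ *ₚ η)) (+-cong (eval-monomial-* g b β η) (eval-* g ξ η))

  eval-sum : ∀ {m} (G : Fin m → Exponent n → Carrier) (v : Vector Carrier m) ξ →
             eval (λ β → sum (λ i → v i * G i β)) ξ ≈ sum (λ i → v i * eval (G i) ξ)
  eval-sum {m} G v []            = sym (sum-zero {m} λ i → zeroʳ (v i))
  eval-sum {m} G v ((b , β) ∷ ξ) = begin
    b * sum (λ i → v i * G i β) + eval (λ β → sum (λ i → v i * G i β)) ξ
      ≈⟨ +-cong (*-distribˡ-sum b (λ i → v i * G i β)) (eval-sum G v ξ) ⟩
    sum (λ i → b * (v i * G i β)) + sum (λ i → v i * eval (G i) ξ)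
      ≈⟨ ∑-distrib-+ (λ i → b * (v i * G i β)) (λ i → v i * eval (G i) ξ) ⟨
    sum (λ i → b * (v i * G i β) + v i * eval (G i) ξ)
      ≈⟨ (sum-cong λ i → solve 4 (λ b v g e → b :* (v :* g) :+ v :* e := v :* (b :* g :+ e)) refl b (v i) (G i β) (eval (G i) ξ)) ⟩
    sum (λ i → v i * (b * G i β + eval (G i) ξ)) ∎

  eval-linear : ∀ g v → eval g (linear v) ≈ sum (λ i → v i * g (inc i 0ᴱ))
  -- Generalised over the enumeration `h`, since the induction leaves `allFin`.
  eval-linear g v = go (λ i → i)
    where
    go : ∀ {m} (h : Fin m → Fin n) →
         eval g (map (λ i → v i , indicator ⁅ i ⁆) (tabulate h)) ≈ sum (λ i → v (h i) * g (inc (h i) 0ᴱ))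
    go {zero}  h = refl
    go {suc m} h = +-cong (*-congˡ (reflexive (cong g (indicator-⁅⁆ (h zero))))) (go (λ i → h (suc i)))

  coeff≈eval : ∀ ξ α → coeff ξ α ≈ eval (λ β → 𝟙 (β ≟ᴱ α)) ξ
  coeff≈eval []            α = refl
  coeff≈eval ((b , β) ∷ ξ) α with β ≟ᴱ α
  ... | yes _ = +-cong (sym (*-identityʳ b)) (coeff≈eval ξ α)
  ... | no  _ = trans (coeff≈eval ξ α) (sym (trans (+-congʳ (zeroʳ b)) (+-identityˡ _)))

  coeff-++ : ∀ p q α → coeff (p ++ q) α ≈ coeff p α + coeff q α
  coeff-++ p q α = trans (coeff≈eval (p ++ q) α) (trans (eval-++ _ p q)
    (sym (+-cong (coeff≈eval p α) (coeff≈eval q α))))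

  coeff-∙ : ∀ x p α → coeff (x ∙ₚ p) α ≈ x * coeff p α
  coeff-∙ x p α = trans (coeff≈eval (x ∙ₚ p) α) (trans (eval-∙ _ x p) (*-congˡ (sym (coeff≈eval p α))))

  coeff-• : ∀ ξ p α → coeff (ξ • p) α ≈ eval (λ β → coeff (∂^ β p) α) ξ
  coeff-• []            p α = refl
  coeff-• ((b , β) ∷ ξ) p α = trans (coeff-++ (b ∙ₚ ∂^ β p) (ξ • p) α) (+-cong (coeff-∙ b (∂^ β p) α) (coeff-• ξ p α))

  eval-vanish : ∀ {g ξ} → All (λ t → g (proj₂ t) ≈ 0#) ξ → eval g ξ ≈ 0#
  eval-vanish []          = refl
  eval-vanish (g≈0 ∷ all) = trans (+-cong (trans (*-congˡ g≈0) (zeroʳ _)) (eval-vanish all)) (+-identityˡ 0#)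

  eval-split : ∀ g δ ξ → eval g ξ ≈ coeff ξ δ * g δ + eval (λ β → if does (β ≟ᴱ δ) then 0# else g β) ξ
  eval-split g δ []            = sym (trans (+-identityʳ _) (zeroˡ _))
  eval-split g δ ((b , β) ∷ ξ) with β ≟ᴱ δ
  ... | yes ≡.refl = trans (+-congˡ (eval-split g δ ξ))
    (solve 4 (λ b g c e → b :* g :+ (c :* g :+ e) := (b :+ c) :* g :+ (b :* :0 :+ e)) refl b (g β) (coeff ξ δ) _)
  ... | no  _      = trans (+-congˡ (eval-split g δ ξ))
    (solve 3 (λ x y z → x :+ (y :+ z) := y :+ (x :+ z)) refl (b * g β) _ _)

  -- A sum with zero coefficients may still contain terms that cancel. Go through the exponents
  -- occurring in `ξ`, setting `g` to zero at one of them each time: by `eval-split` the value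
  -- changes by a multiple of a vanishing coefficient.
  eval-null : ∀ g ξ → ξ ≈ₚ 0ₚ → eval g ξ ≈ 0#
  eval-null g ξ ξ≈0 = go (map proj₂ ξ) g (All.tabulate λ t∈ξ → inj₁ (∈-map⁺ proj₂ t∈ξ))
    where
    go : ∀ Δ g → All (λ t → proj₂ t ∈ˡ Δ ⊎ g (proj₂ t) ≈ 0#) ξ → eval g ξ ≈ 0#
    go []      g supp = eval-vanish (All.map (λ { (inj₁ ()) ; (inj₂ g≈0) → g≈0 }) supp)
    go (δ ∷ Δ) g supp = trans (eval-split g δ ξ) (trans
      (+-cong (trans (*-congʳ (ξ≈0 δ)) (zeroˡ (g δ))) (go Δ g′ (All.map (λ {t} → step {t}) supp))) (+-identityˡ 0#))
      where
      g′ : Exponent n → Carrier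
      g′ β = if does (β ≟ᴱ δ) then 0# else g β
      step : ∀ {t : Carrier × Exponent n} → proj₂ t ∈ˡ δ ∷ Δ ⊎ g (proj₂ t) ≈ 0# → proj₂ t ∈ˡ Δ ⊎ g′ (proj₂ t) ≈ 0#
      step {_ , β} s with β ≟ᴱ δ | s
      ... | yes _  | _                 = inj₂ refl
      ... | no β≢δ | inj₁ (here β≡δ)   = contradiction β≡δ β≢δ
      ... | no _   | inj₁ (there β∈Δ)  = inj₁ β∈Δ
      ... | no _   | inj₂ g≈0          = inj₂ g≈0

  sum-single : ∀ {m} (f : Vector Carrier m) j → (∀ i → i ≢ j → f i ≈ 0#) → sum f ≈ f j
  sum-single {suc m} f zero f≈0 = trans (+-congˡ (sum-zero {m} {f = λ i → f (suc i)} λ i → f≈0 (suc i) λ ())) (+-identityʳ (f zero))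
  sum-single f (suc j) f≈0 = trans
    (+-cong (f≈0 zero λ ()) (sum-single (λ i → f (suc i)) j λ i i≢j → f≈0 (suc i) λ { ≡.refl → i≢j ≡.refl }))
    (+-identityˡ (f (suc j)))

  inc-0ᴱ-injective : ∀ {i j : Fin n} → inc i 0ᴱ ≡ inc j 0ᴱ → i ≡ j
  inc-0ᴱ-injective {i} {j} eq = Subsetₚ.x∈⁅y⁆⇒x≡y j (≡.subst (i ∈_)
    (indicator-injective (≡.trans (indicator-⁅⁆ i) (≡.trans eq (≡.sym (indicator-⁅⁆ j))))) (Subsetₚ.x∈⁅x⁆ i))

  coeff-linear : ∀ v j → coeff (linear v) (inc j 0ᴱ) ≈ v j
  coeff-linear v j = begin
    coeff (linear v) (inc j 0ᴱ)                             ≈⟨ coeff≈eval (linear v) (inc j 0ᴱ) ⟩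
    eval (λ β → 𝟙 (β ≟ᴱ inc j 0ᴱ)) (linear v)               ≈⟨ eval-linear _ v ⟩
    sum (λ i → v i * 𝟙 (inc i 0ᴱ ≟ᴱ inc j 0ᴱ))              ≈⟨ sum-single _ j (λ i i≢j → trans
        (*-congˡ (𝟙-false (inc i 0ᴱ ≟ᴱ inc j 0ᴱ) (λ eq → i≢j (inc-0ᴱ-injective eq)))) (zeroʳ (v i))) ⟩
    v j * 𝟙 (inc j 0ᴱ ≟ᴱ inc j 0ᴱ)                          ≈⟨ *-congˡ (𝟙-true (inc j 0ᴱ ≟ᴱ inc j 0ᴱ) ≡.refl) ⟩
    v j * 1#                                                ≈⟨ *-identityʳ (v j) ⟩
    v j                                                     ∎

  sum-inc-0ᴱ : ∀ (i : Fin n) → Vec.sum (inc i (0ᴱ {n})) ≡ 1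
  sum-inc-0ᴱ i = ≡.trans (sum-inc {n} i 0ᴱ) (cong suc (sum-0ᴱ n))

  homogeneous-linear : ∀ v → Homogeneous 1 (linear v)
  homogeneous-linear v α coeff≉0 = decidable-stable (Vec.sum α ℕₚ.≟ 1) λ Σα≢1 → coeff≉0 (begin
    coeff (linear v) α                          ≈⟨ coeff≈eval (linear v) α ⟩
    eval (λ β → 𝟙 (β ≟ᴱ α)) (linear v)          ≈⟨ eval-linear _ v ⟩
    sum (λ i → v i * 𝟙 (inc i 0ᴱ ≟ᴱ α))         ≈⟨ (sum-zero {n} λ i → trans
        (*-congˡ (𝟙-false (inc i 0ᴱ ≟ᴱ α) λ { ≡.refl → Σα≢1 (sum-inc-0ᴱ i) })) (zeroʳ (v i))) ⟩
    0#                                          ∎)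

  infix 4 _≋_
  -- Agreement with `linear v` under all functionals; in this form it can be substituted inside
  -- evaluations of products.
  _≋_ : Poly → Vector Carrier n → Set _
  ξ ≋ v = ∀ g → eval g ξ ≈ sum (λ i → v i * g (inc i 0ᴱ))

  homogeneous⇒≋ : ∀ {ξ} → Homogeneous 1 ξ → ξ ≋ (λ i → coeff ξ (inc i 0ᴱ))
  homogeneous⇒≋ {ξ} hom g = begin
    eval g ξ                                             ≈⟨ solve 2 (λ x y → x := x :+ :- :1 :* y :+ y) refl (eval g ξ) (eval g (linear v)) ⟩
    eval g ξ + - 1# * eval g (linear v) + eval g (linear v) ≈⟨ +-congʳ (trans (eval-++ g ξ _) (+-congˡ (eval-∙ g (- 1#) (linear v)))) ⟨
    eval g (ξ -ₚ linear v) + eval g (linear v)           ≈⟨ +-cong (eval-null g (ξ -ₚ linear v) difference) (eval-linear g v) ⟩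
    0# + sum (λ i → v i * g (inc i 0ᴱ))                  ≈⟨ +-identityˡ _ ⟩
    sum (λ i → v i * g (inc i 0ᴱ))                       ∎
    where
    v : Vector Carrier n
    v i = coeff ξ (inc i 0ᴱ)
    homogeneous-zero : ∀ {p} {α : Exponent n} → Homogeneous 1 p → Vec.sum α ≢ 1 → coeff p α ≈ 0#
    homogeneous-zero {p} {α} hom Σα≢1 = decidable-stable (coeff p α ≟ 0#) λ coeff≉0 → Σα≢1 (hom α coeff≉0)
    same : ∀ α → coeff ξ α ≈ coeff (linear v) α
    same α with Vec.sum α ℕₚ.≟ 1
    ... | no Σα≢1 = trans (homogeneous-zero {ξ} hom Σα≢1) (sym (homogeneous-zero {linear v} (homogeneous-linear v) Σα≢1))
    ... | yes Σα≡1 with sum-suc⇒inc α Σα≡1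
    ...   | j , γ , ≡.refl , Σγ≡0 rewrite sum≡0⇒0ᴱ γ Σγ≡0 = sym (coeff-linear v j)
    difference : ξ -ₚ linear v ≈ₚ 0ₚ
    difference α = begin
      coeff (ξ -ₚ linear v) α                       ≈⟨ trans (coeff-++ ξ _ α) (+-congˡ (coeff-∙ (- 1#) (linear v) α)) ⟩
      coeff ξ α + - 1# * coeff (linear v) α         ≈⟨ +-congʳ (same α) ⟩
      coeff (linear v) α + - 1# * coeff (linear v) α ≈⟨ solve 1 (λ x → x :+ :- :1 :* x := :0) refl (coeff (linear v) α) ⟩
      0#                                            ∎

  ·-zero : ∀ k → k · 0# ≈ 0#
  ·-zero zero    = refl
  ·-zero (suc k) = trans (+-identityˡ _) (·-zero k)

  coeff-∂ : ∀ e p α → coeff (∂ e p) α ≈ suc (lookup α e) · coeff p (inc e α)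
  coeff-∂ e []            α = sym (·-zero (suc (lookup α e)))
  coeff-∂ e ((b , β) ∷ p) α with updateAt β e pred ≟ᴱ α | β ≟ᴱ inc e α
  ... | yes _ | yes ≡.refl = trans
    (+-cong (reflexive (cong (_· b) (Vecₚ.lookup∘updateAt e α))) (coeff-∂ e p α))
    (sym (CommutativeMonoidMult.×-distrib-+ +-commutativeMonoid b (coeff p (inc e α)) (suc (lookup α e))))
  ... | no β-≢α | yes ≡.refl = contradiction (≡.trans (Vecₚ.updateAt-updateAt e α) (Vecₚ.updateAt-id e α)) β-≢α
  ... | no _ | no _ = coeff-∂ e p α
  ... | yes β-≡α | no β≢ with lookup β e in eq
  -- Here `pred` truncates and the exponents match by accident, but the term carries the
  -- multiplicity zero.
  ...   | zero  = trans (+-identityˡ _) (coeff-∂ e p α)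
  ...   | suc k = contradiction (≡.trans (≡.sym (≡.trans (Vecₚ.updateAt-updateAt e β)
          (Vecₚ.updateAt-id-local e β (≡.trans (cong (λ m → suc (pred m)) eq) (≡.sym eq))))) (cong (inc e) β-≡α)) β≢

  Multiaffine : Poly → Set ℓ
  Multiaffine p = ∀ γ i → 2 ℕ.≤ lookup γ i → coeff p γ ≈ 0#

  -- If `lookup α e` is zero the factor in `coeff-∂` is one; otherwise `inc e α` has an entry of at
  -- least two and both sides vanish. Differentiation of multiaffine polynomials is thus a pure
  -- shift of exponents.
  multiaffine-coeff-∂ : ∀ {p} → Multiaffine p → ∀ e α → coeff (∂ e p) α ≈ coeff p (inc e α)
  multiaffine-coeff-∂ {p} ma e α = by-cases (lookup α e) ≡.refl
    where
    by-cases : ∀ k → lookup α e ≡ k → coeff (∂ e p) α ≈ coeff p (inc e α)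
    by-cases zero    eq = trans (coeff-∂ e p α) (trans (reflexive (cong (λ k → suc k · coeff p (inc e α)) eq)) (+-identityʳ _))
    by-cases (suc k) eq = trans (coeff-∂ e p α) (trans (×-congʳ (suc (lookup α e)) c≈0) (trans (·-zero (suc (lookup α e))) (sym c≈0)))
      where
      c≈0 : coeff p (inc e α) ≈ 0#
      c≈0 = ma (inc e α) e (≡.subst (2 ℕ.≤_) (≡.sym (≡.trans (Vecₚ.lookup∘updateAt e α) (cong suc eq))) (s≤s (s≤s z≤n)))

  multiaffine-∂ : ∀ {p} → Multiaffine p → ∀ e → Multiaffine (∂ e p)
  multiaffine-∂ {p} ma e γ i 2≤γi = trans (multiaffine-coeff-∂ {p} ma e γ)
    (ma (inc e γ) i (ℕₚ.≤-trans 2≤γi (lookup≤inc i e γ)))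

  multiaffine-fold-∂ : ∀ {p} → Multiaffine p → ∀ e k → Multiaffine (fold p (∂ e) k)
  multiaffine-fold-∂ ma e zero    = ma
  multiaffine-fold-∂ {p} ma e (suc k) = multiaffine-∂ {fold p (∂ e) k} (multiaffine-fold-∂ {p} ma e k) e

  coeff-fold-∂ : ∀ {p} → Multiaffine p → ∀ e k α → coeff (fold p (∂ e) k) α ≈ coeff p (updateAt α e (k ℕ.+_))
  coeff-fold-∂ {p} ma e zero    α = reflexive (cong (coeff p) (≡.sym (Vecₚ.updateAt-id e α)))
  coeff-fold-∂ {p} ma e (suc k) α = begin
    coeff (∂ e (fold p (∂ e) k)) α                   ≈⟨ multiaffine-coeff-∂ {fold p (∂ e) k} (multiaffine-fold-∂ {p} ma e k) e α ⟩
    coeff (fold p (∂ e) k) (inc e α)                 ≈⟨ coeff-fold-∂ {p} ma e k (inc e α) ⟩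
    coeff p (updateAt (inc e α) e (k ℕ.+_))          ≡⟨ cong (coeff p) (≡.trans (Vecₚ.updateAt-updateAt e α)
                                                          (Vecₚ.updateAt-cong e (ℕₚ.+-suc k) α)) ⟩
    coeff p (updateAt α e (suc k ℕ.+_))              ∎

  multiaffine-coeff-∂^ : ∀ {p} → Multiaffine p → ∀ β α → coeff (∂^ β p) α ≈ coeff p (β ⊕ α)
  multiaffine-coeff-∂^ {p} ma β α = trans (proj₂ (go (allFin n)) α) (reflexive (cong (coeff p) (shift-allFin β α)))
    where
    step : Fin n → Poly → Poly
    step e q = fold q (∂ e) (lookup β e)
    go : ∀ es → Multiaffine (foldr step p es) × (∀ α → coeff (foldr step p es) α ≈ coeff p (shift β es α))
    go []       = ma , λ α → refl
    go (e ∷ es) with go es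
    ... | ma′ , eq = multiaffine-fold-∂ {foldr step p es} ma′ e (lookup β e) ,
      λ α → trans (coeff-fold-∂ {foldr step p es} ma′ e (lookup β e) α) (eq _)

  -- Coefficients of the basis generating polynomial.

  module BasisPolynomial (M : Matroid n) where
    open MatroidProperties M

    f = basisPolynomial ℝ M

    private
      terms : List (Subset n) → Poly
      terms = map (λ B → 1# , indicator B)

      coeff-∉ : ∀ {γ} Bs → All (λ B → indicator B ≢ γ) Bs → coeff (terms Bs) γ ≈ 0#
      coeff-∉ []       []           = refl
      coeff-∉ {γ} (B ∷ Bs) (B≢γ ∷ ≢γ) with indicator B ≟ᴱ γ
      ... | yes B≡γ = contradiction B≡γ B≢γ
      ... | no  _   = coeff-∉ Bs ≢γ

      -- Uniqueness prevents a second copy of the term from adding to the coefficient.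
      coeff-∈ : ∀ {B Bs} → Unique Bs → B ∈ˡ Bs → coeff (terms Bs) (indicator B) ≈ 1#
      coeff-∈ {B} {B′ ∷ Bs} (B′≢ ∷ uniq) B∈ with indicator B′ ≟ᴱ indicator B | B∈
      ... | yes eq | _ with indicator-injective {I = B′} eq
      ...   | ≡.refl = trans (+-congˡ (coeff-∉ Bs (All.map (λ B≢ eq → B≢ (≡.sym (indicator-injective eq))) B′≢))) (+-identityʳ 1#)
      coeff-∈ {B} {B′ ∷ Bs} (B′≢ ∷ uniq) B∈ | no ≢B | here ≡.refl = contradiction ≡.refl ≢B
      coeff-∈ {B} {B′ ∷ Bs} (B′≢ ∷ uniq) B∈ | no ≢B | there B∈Bs  = coeff-∈ uniq B∈Bs

    coeff-basisPolynomial : ∀ γ → coeff f γ ≈ 𝟙 (isBasis? γ)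
    coeff-basisPolynomial γ = by-cases (isBasis? γ)
      where
      by-cases : Dec (Independent γ × Vec.sum γ ≡ rank M) → coeff f γ ≈ 𝟙 (isBasis? γ)
      by-cases (yes basis@((B , indB , ≡.refl) , Σ≡rank)) = trans
        (coeff-∈ (Uniqueₚ.filter⁺ (Basis? M) (subsets-unique n)) (∈-filter⁺ (Basis? M) (subsets-complete B)
          (∣∣≡rank⇒basis indB (≡.trans (≡.sym (sum-indicator B)) Σ≡rank))))
        (sym (𝟙-true (isBasis? γ) basis))
      by-cases (no ¬basis) = trans
        (coeff-∉ (filter (Basis? M) (subsets n)) (All.tabulate λ {B} B∈ B≡γ →
          let basis = proj₂ (∈-filter⁻ (Basis? M) {xs = subsets n} B∈) in
          ¬basis ((B , proj₁ basis , B≡γ) , ≡.trans (cong Vec.sum (≡.sym B≡γ)) (≡.trans (sum-indicator B) (basis⇒∣∣≡rank basis)))))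
        (sym (𝟙-false (isBasis? γ) ¬basis))

    multiaffine : Multiaffine f
    multiaffine γ i 2≤γi = trans (coeff-basisPolynomial γ)
      (𝟙-false (isBasis? γ) λ (ind , _) → ℕₚ.<⇒≱ 2≤γi (independent⇒≤1 ind i))

    coeff-•f : ∀ ξ α → coeff (ξ • f) α ≈ eval (λ β → 𝟙 (isBasis? (β ⊕ α))) ξ
    coeff-•f ξ α = trans (coeff-• ξ f α) (eval-cong (λ β →
      trans (multiaffine-coeff-∂^ {f} multiaffine β α) (coeff-basisPolynomial (β ⊕ α))) ξ)

-- From the graded algebra to the forms of mixed derivatives.

module HodgeRiemann {c ℓ} (ℝ : CompleteOrderedField c ℓ) {n} (M : Matroid n)
                    (a : Vector (CompleteOrderedField.Carrier ℝ) n) where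
  open OrderedField ℝ
  open ParallelClasses ℝ
  open Polynomials ℝ n
  open Evaluation ℝ n
  open BasisPolynomial M
  open MatroidProperties M
  open MixedDerivatives ℝ M a
  open GradedAlgebra ℝ n f (rank M)
  open SetoidReasoning setoid

  l : Poly
  l = linear a

  private
    ψ : Exponent n → Carrier
    ψ = Φ 0

  Φ-cong : ∀ k {α β} → α ≡ β → Φ k α ≈ Φ k β
  Φ-cong k eq = reflexive (cong (Φ k) eq)

  -- Each factor `l` contributes one derivative along `a`, which is the recursion defining `Φ`.
  eval-power : ∀ k α → eval (λ γ → ψ (α ⊕ γ)) (l ^ₚ k) ≈ Φ k α
  eval-power zero    α = trans (+-identityʳ _) (trans (*-identityˡ _) (Φ-cong 0 (⊕-identityʳ α)))
  eval-power (suc k) α = begin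
    eval (λ γ → ψ (α ⊕ γ)) (l *ₚ l ^ₚ k)                             ≈⟨ eval-* _ l (l ^ₚ k) ⟩
    eval (λ β → eval (λ γ → ψ (α ⊕ (β ⊕ γ))) (l ^ₚ k)) l             ≈⟨ eval-linear _ a ⟩
    sum (λ i → a i * eval (λ γ → ψ (α ⊕ (inc i 0ᴱ ⊕ γ))) (l ^ₚ k))   ≈⟨ (sum-cong λ i → *-congˡ (trans
        (eval-cong (λ γ → Φ-cong 0 (≡.trans (≡.sym (⊕-assoc α _ γ)) (cong (_⊕ γ) (≡.trans (⊕-inc i α 0ᴱ) (cong (inc i) (⊕-identityʳ α)))))) (l ^ₚ k))
        (eval-power k (inc i α)))) ⟩
    Φ (suc k) α                                                      ∎

  ≋-coeff-• : ∀ ξ {v} → ξ ≋ v → ∀ α → coeff (ξ • f) α ≈ D 0 α v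
  ≋-coeff-• ξ {v} ξ≋v α = begin
    coeff (ξ • f) α                          ≈⟨ coeff-•f ξ α ⟩
    eval (λ β → ψ (β ⊕ α)) ξ                 ≈⟨ ξ≋v _ ⟩
    sum (λ i → v i * ψ (inc i 0ᴱ ⊕ α))       ≈⟨ (sum-cong λ i → *-congˡ (Φ-cong 0 (inc-0ᴱ-⊕ i α))) ⟩
    D 0 α v                                  ∎

  ≋-coeff-power-• : ∀ ξ {v} → ξ ≋ v → ∀ k α → coeff ((l ^ₚ k *ₚ ξ) • f) α ≈ D k α v
  ≋-coeff-power-• ξ {v} ξ≋v k α = begin
    coeff ((l ^ₚ k *ₚ ξ) • f) α                                       ≈⟨ coeff-•f (l ^ₚ k *ₚ ξ) α ⟩
    eval (λ β → ψ (β ⊕ α)) (l ^ₚ k *ₚ ξ)                            ≈⟨ eval-* _ (l ^ₚ k) ξ ⟩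
    eval (λ β → eval (λ γ → ψ (β ⊕ γ ⊕ α)) ξ) (l ^ₚ k)              ≈⟨ eval-cong (λ β → ξ≋v _) (l ^ₚ k) ⟩
    eval (λ β → sum (λ i → v i * ψ (β ⊕ inc i 0ᴱ ⊕ α))) (l ^ₚ k)    ≈⟨ eval-sum _ v (l ^ₚ k) ⟩
    sum (λ i → v i * eval (λ β → ψ (β ⊕ inc i 0ᴱ ⊕ α)) (l ^ₚ k))    ≈⟨ (sum-cong λ i → *-congˡ (trans
        (eval-cong (λ β → Φ-cong 0 (≡.trans (⊕-assoc β _ α) (≡.trans (⊕-comm β _) (cong (_⊕ β) (inc-0ᴱ-⊕ i α))))) (l ^ₚ k))
        (eval-power k (inc i α)))) ⟩
    D k α v                                                         ∎

  ≋-deg : ∀ ξ {v} → ξ ≋ v → ∀ k → deg (ξ *ₚ ξ *ₚ l ^ₚ k) ≈ H.form k 0ᴱ v v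
  ≋-deg ξ {v} ξ≋v k = begin
    deg (ξ *ₚ ξ *ₚ l ^ₚ k)                                          ≈⟨ coeff-•f (ξ *ₚ ξ *ₚ l ^ₚ k) 0ᴱ ⟩
    eval (λ β → ψ (β ⊕ 0ᴱ)) (ξ *ₚ ξ *ₚ l ^ₚ k)                      ≈⟨ eval-* _ (ξ *ₚ ξ) (l ^ₚ k) ⟩
    eval (λ β → eval (λ γ → ψ (β ⊕ γ ⊕ 0ᴱ)) (l ^ₚ k)) (ξ *ₚ ξ)      ≈⟨ eval-cong (λ β → trans
        (eval-cong (λ γ → Φ-cong 0 (⊕-identityʳ (β ⊕ γ))) (l ^ₚ k)) (eval-power k β)) (ξ *ₚ ξ) ⟩
    eval (Φ k) (ξ *ₚ ξ)                                             ≈⟨ eval-* _ ξ ξ ⟩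
    eval (λ β → eval (λ γ → Φ k (β ⊕ γ)) ξ) ξ                       ≈⟨ ξ≋v _ ⟩
    sum (λ i → v i * eval (λ γ → Φ k (inc i 0ᴱ ⊕ γ)) ξ)             ≈⟨ (sum-cong λ i → *-congˡ (trans (ξ≋v _) (sum-cong λ j →
        trans (*-congˡ (Φ-cong k (inc-0ᴱ-⊕ i (inc j 0ᴱ)))) (*-comm (v j) _)))) ⟩
    H.form k 0ᴱ v v                                                 ∎

  -- Subtracting 0ₚ = [] leaves a formal sum unchanged up to a trailing ++ [].
  Ann⇒≈ᴬ0 : ∀ ξ → (∀ α → coeff (ξ • f) α ≈ 0#) → ξ ≈ᴬ 0ₚ
  Ann⇒≈ᴬ0 ξ ann = ≡.subst Ann (≡.sym (Listₚ.++-identityʳ ξ)) ann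

  ≈ᴬ0⇒Ann : ∀ ξ → ξ ≈ᴬ 0ₚ → ∀ α → coeff (ξ • f) α ≈ 0#
  ≈ᴬ0⇒Ann ξ = ≡.subst Ann (Listₚ.++-identityʳ ξ)

  Φ-degree : ∀ k α → Vec.sum α ℕ.+ k ≢ rank M → Φ k α ≈ 0#
  Φ-degree zero    α ≢d = 𝟙-false (isBasis? α) λ (_ , Σ≡d) → ≢d (≡.trans (ℕₚ.+-identityʳ _) Σ≡d)
  Φ-degree (suc k) α ≢d = sum-zero {n} λ i → trans (*-congˡ (Φ-degree k (inc i α) λ eq →
    ≢d (≡.trans (ℕₚ.+-suc _ k) (≡.trans (≡.sym (cong (ℕ._+ k) (sum-inc i α))) eq)))) (zeroʳ (a i))

  Null⇒D≈0 : ∀ k {α v} → Null k α v → ∀ γ → Vec.sum γ ≡ k → D 0 (γ ⊕ α) v ≈ 0#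
  Null⇒D≈0 zero {α} {v} null γ Σγ≡0 = trans (reflexive (cong (λ β → D 0 β v)
    (≡.trans (cong (_⊕ α) (sum≡0⇒0ᴱ γ Σγ≡0)) (≡.trans (⊕-comm 0ᴱ α) (⊕-identityʳ α))))) null
  Null⇒D≈0 (suc k) {α} {v} null γ Σγ≡ with sum-suc⇒inc γ Σγ≡
  ... | i , γ′ , ≡.refl , Σγ′≡k = trans (reflexive (cong (λ β → D 0 β v)
    (≡.trans (inc-⊕ i γ′ α) (≡.sym (⊕-inc i γ′ α))))) (Null⇒D≈0 k (null i) γ′ Σγ′≡k)

  module _ {k} (rank≡ : rank M ≡ suc (suc k)) where

    private
      rank∸2≡k : rank M ℕ.∸ 2 ≡ k
      rank∸2≡k = cong (ℕ._∸ 2) rank≡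

    ≋-Q : ∀ ξ {v} → ξ ≋ v → Q 1 l ξ ξ ≈ - H.form k 0ᴱ v v
    ≋-Q ξ {v} ξ≋v = begin
      - 1# * 1# * deg (ξ *ₚ ξ *ₚ l ^ₚ (rank M ℕ.∸ 2))    ≈⟨ *-congˡ (≋-deg ξ ξ≋v (rank M ℕ.∸ 2)) ⟩
      - 1# * 1# * H.form (rank M ℕ.∸ 2) 0ᴱ v v           ≡⟨ cong (λ m → - 1# * 1# * H.form m 0ᴱ v v) rank∸2≡k ⟩
      - 1# * 1# * H.form k 0ᴱ v v                        ≈⟨ solve 1 (λ x → :- :1 :* :1 :* x := :- x) refl _ ⟩
      - H.form k 0ᴱ v v                                  ∎

    primitive⇒ : ∀ ξ → Primitive 1 l ξ → ∀ {v} → ξ ≋ v → D (suc k) 0ᴱ v ≈ 0#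
    primitive⇒ ξ (_ , prim) {v} ξ≋v = trans (sym (≋-coeff-power-• ξ ξ≋v (suc k) 0ᴱ))
      (trans (reflexive (cong (λ m → coeff ((l ^ₚ suc m *ₚ ξ) • f) 0ᴱ) (≡.sym rank∸2≡k))) (≈ᴬ0⇒Ann (l ^ₚ suc (rank M ℕ.∸ 2) *ₚ ξ) prim 0ᴱ))

    primitive-l : (∀ α → Φ (suc (suc k)) α ≈ 0#) → Primitive 1 l l
    primitive-l Φ≈0 = homogeneous-linear a , Ann⇒≈ᴬ0 (l ^ₚ suc (rank M ℕ.∸ 2) *ₚ l) λ α → trans
      (reflexive (cong (λ m → coeff ((l ^ₚ suc m *ₚ l) • f) α) rank∸2≡k))
      -- `D (suc k) α a` is `Φ (suc (suc k)) α` by definition.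
      (trans (≋-coeff-power-• l (λ g → eval-linear g a) (suc k) α) (Φ≈0 α))

-- The two implications.

module _ {c ℓ} (ℝ : CompleteOrderedField c ℓ) {n} (M : Matroid n) {k} (rank≡ : rank M ≡ suc (suc k)) (e : Fin n) where
  open OrderedField ℝ
  open ParallelClasses ℝ
  open Polynomials ℝ n
  open Evaluation ℝ n
  open BasisPolynomial M
  open MatroidProperties M
  open GradedAlgebra ℝ n f (rank M)
  open SetoidReasoning setoid

  0ᴱ-independent : Independent 0ᴱ
  0ᴱ-independent = Subset.⊥ , Matroid.empty M , indicator-⊥ n

  ¬coloop⇒HRR : ¬ Coloop M e → MatroidHRR-on ℝ M 1 (relintH ℝ e)
  ¬coloop⇒HRR ¬coloop a a-relint ξ prim@(hom , _) ξ≉0 = <-respʳ-≈ (sym (≋-Q rank≡ ξ ξ≋v)) (<0⇒0<- form<0)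
    where
    open HodgeRiemann ℝ M a
    open MixedDerivatives ℝ M a
    open Positivity ℝ M a e a-relint ¬coloop
    v : Vector Carrier n
    v i = coeff ξ (inc i 0ᴱ)
    ξ≋v : ξ ≋ v
    ξ≋v = homogeneous⇒≋ {ξ} hom
    degree : Vec.sum (0ᴱ {n}) ℕ.+ suc (suc k) ≡ rank M
    degree = ≡.trans (cong (ℕ._+ suc (suc k)) (sum-0ᴱ n)) (≡.sym rank≡)
    av≈0 : H.form k 0ᴱ a v ≈ 0#
    av≈0 = trans (form-a k 0ᴱ v) (primitive⇒ rank≡ ξ prim ξ≋v)
    -- l_v f_M is homogeneous of degree `suc k`, so only exponents of that size matter, and these
    -- are covered by `Null`.
    annihilates : H.form k 0ᴱ v v ≈ 0# → ∀ α → coeff (ξ • f) α ≈ 0#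
    annihilates vv≈0 α = trans (≋-coeff-• ξ ξ≋v α) (by-cases (Vec.sum α ℕₚ.≟ suc k))
      where
      by-cases : Dec (Vec.sum α ≡ suc k) → D 0 α v ≈ 0#
      by-cases (yes Σα≡) = trans (reflexive (cong (λ β → D 0 β v) (≡.sym (⊕-identityʳ α))))
        (Null⇒D≈0 (suc k) (isotropic⇒Null k 0ᴱ v degree av≈0 vv≈0) α Σα≡)
      by-cases (no Σα≢) = sum-zero {n} λ i → trans (*-congˡ (Φ-degree 0 (inc i α) λ eq →
        Σα≢ (ℕₚ.suc-injective (≡.trans (≡.sym (sum-inc i α)) (≡.trans (≡.sym (ℕₚ.+-identityʳ _)) (≡.trans eq rank≡))))))
        (zeroʳ (v i))
    form<0 : H.form k 0ᴱ v v < 0#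
    form<0 with negative k 0ᴱ 0ᴱ-independent degree v av≈0
    ... | inj₁ vv<0 = vv<0
    ... | inj₂ vv≈0 = contradiction (Ann⇒≈ᴬ0 ξ (annihilates vv≈0)) ξ≉0

  module ColoopCase (coloop : Coloop M e) where
    a : Vector Carrier n
    a i = 𝟙 (¬? (i Finₚ.≟ e))

    ae≈0 : a e ≈ 0#
    ae≈0 = 𝟙-false (¬? (e Finₚ.≟ e)) λ e≢e → e≢e ≡.refl

    0<a : ∀ i → i ≢ e → 0# < a i
    0<a i i≢e = <-respʳ-≈ (sym (𝟙-true (¬? (i Finₚ.≟ e)) i≢e)) 0<1

    open HodgeRiemann ℝ M a
    open MixedDerivatives ℝ M a

    -- As the weight of `e` is zero, the power of l_a never differentiates by `e`; if ∂^α does not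
    -- either, no basis is reached, because every basis contains `e`.
    Φ-avoiding-e : ∀ m α → lookup α e ≡ 0 → Φ m α ≈ 0#
    Φ-avoiding-e zero    α αe≡0 = 𝟙-false (isBasis? α) λ where
      ((B , indB , ≡.refl) , Σ≡rank) → case ≡.trans (≡.sym αe≡0) (∈⇒indicator≡1
        (coloop B (∣∣≡rank⇒basis indB (≡.trans (≡.sym (sum-indicator B)) Σ≡rank)))) of λ ()
    Φ-avoiding-e (suc m) α αe≡0 = sum-zero {n} λ i → term i (i Finₚ.≟ e)
      where
      term : ∀ i → Dec (i ≡ e) → a i * Φ m (inc i α) ≈ 0#
      term i (yes ≡.refl) = trans (*-congʳ ae≈0) (zeroˡ _)
      term i (no  i≢e)    = trans (*-congˡ (Φ-avoiding-e m (inc i α)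
        (≡.trans (lookup-inc-≢ α (λ e≡i → i≢e (≡.sym e≡i))) αe≡0))) (zeroʳ (a i))

    Φ-rank≈0 : ∀ α → Φ (suc (suc k)) α ≈ 0#
    Φ-rank≈0 α with lookup α e in eq
    ... | zero  = Φ-avoiding-e (suc (suc k)) α eq
    -- A nonzero exponent together with a full power of l_a differentiates more often than the
    -- degree of `f_M`.
    ... | suc m = Φ-degree (suc (suc k)) α λ Σ+d≡d → contradiction
      (ℕₚ.≤-trans (≡.subst (1 ℕ.≤_) (≡.sym eq) (s≤s z≤n)) (lookup≤sum α e))
      (≡.subst (λ s → ¬ 1 ℕ.≤ s) (≡.sym (ℕₚ.+-cancelʳ-≡ (suc (suc k)) (Vec.sum α) 0 (≡.trans Σ+d≡d rank≡))) λ ())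

    -- This is where rank at least two enters: the independent set consisting of `e` alone is
    -- smaller than a basis and can be augmented. Through `x` the operator l_a acts nontrivially on
    -- `f_M`.
    ∃-other-element : ∃ λ B → ∃ λ x → Basis M B × x ∈ B × x ≢ e
    ∃-other-element with rank-attained
    ... | B , indB , ∣B∣≡rank with augment {γ = indicator ⁅ e ⁆} indB
      (⁅ e ⁆ , Matroid.hereditary M (λ x∈⁅e⁆ → ≡.subst (_∈ B) (≡.sym (Subsetₚ.x∈⁅y⁆⇒x≡y e x∈⁅e⁆)) (coloop B (∣∣≡rank⇒basis indB ∣B∣≡rank))) indB , ≡.refl)
      (≡.subst₂ ℕ._<_ (≡.sym (≡.trans (sum-indicator ⁅ e ⁆) (Subsetₚ.∣⁅x⁆∣≡1 e))) (≡.sym (≡.trans ∣B∣≡rank rank≡)) (s≤s (s≤s z≤n)))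
    ...   | x , x∈B , x∉⁅e⁆ , _ = B , x , ∣∣≡rank⇒basis indB ∣B∣≡rank , x∈B , λ where
      ≡.refl → case ≡.trans (≡.sym x∉⁅e⁆) (∈⇒indicator≡1 (Subsetₚ.x∈⁅x⁆ e)) of λ ()

    l≉0 : ¬ l ≈ᴬ 0ₚ
    l≉0 l≈0 with ∃-other-element
    ... | B , x , basis , x∈B , x≢e = irrefl (sym D≈0) 0<D
      where
      α = indicator (B Subset.- x)
      D≈0 : D 0 α a ≈ 0#
      D≈0 = trans (sym (≋-coeff-• l (λ g → eval-linear g a) α)) (≈ᴬ0⇒Ann l l≈0 α)
      0<D : 0# < D 0 α a
      0<D = sum-pos {f = λ i → a i * Φ 0 (inc i α)} (λ i → *-nonneg (𝟙-nonneg (¬? (i Finₚ.≟ e))) (𝟙-nonneg (isBasis? (inc i α)))) x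
        (*-pos (0<a x x≢e) (<-respʳ-≈ (sym (𝟙-true (isBasis? (inc x α)) ((B , proj₁ basis , indicator-remove x∈B) ,
          ≡.trans (cong Vec.sum (≡.sym (indicator-remove x∈B))) (≡.trans (sum-indicator B) (basis⇒∣∣≡rank basis))))) 0<1))

    ¬HRR : ¬ MatroidHRR-on ℝ M 1 (relintH ℝ e)
    ¬HRR hrr = irrefl (sym Q≈0) (hrr a (ae≈0 , 0<a) l (primitive-l rank≡ Φ-rank≈0) l≉0)
      where
      Q≈0 : Q 1 l l l ≈ 0#
      Q≈0 = begin
        Q 1 l l l              ≈⟨ ≋-Q rank≡ l (λ g → eval-linear g a) ⟩
        - H.form k 0ᴱ a a      ≈⟨ -‿cong (trans (form-a k 0ᴱ a) (Φ-rank≈0 0ᴱ)) ⟩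
        - 0#                   ≈⟨ solve 0 (:- :0 := :0) refl ⟩
        0#                     ∎

open import Data.Nat.Base using (_≤_)

theorem4p5p4 : ∀ {c ℓ : Level} (ℝ : CompleteOrderedField c ℓ) {n : ℕ} (M : Matroid n) →
    2 ≤ rank M → (e : Fin n) →
    MatroidHRR-on ℝ M 1 (relintH ℝ e) ⇔ (¬ Coloop M e)
theorem4p5p4 ℝ M 2≤rank e = mk⇔
  (λ hrr coloop → ColoopCase.¬HRR ℝ M rank≡ e coloop hrr)
  (¬coloop⇒HRR ℝ M rank≡ e)
  where
  rank≡ : rank M ≡ suc (suc (rank M ℕ.∸ 2))
  rank≡ = ≡.sym (ℕₚ.m+[n∸m]≡n 2≤rank)
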